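{- For every word $w=x^{k_1-1}y_{s_1}\cdots x^{k_n-1}y_{s_n}\in\mathcal{A}^1_{\mathbb{C}^\times}$ with $n\ge1$, one has the identity of sequences $\nabla\mathtt{s}^{\mathrm{sh}}_w=\mathtt{s}^{\mathrm{sh}}_{\star(w)}$, i.e. $\sum_{i=0}^m(-1)^i\binom{m}{i}\mathtt{s}^{\mathrm{sh}}_w(i)=\mathtt{s}^{\mathrm{sh}}_{\star(w)}(m)$ for all $m\ge0$.
   Context: $\mathcal{A}_{\mathbb{C}^\times}=\mathbb{Q}\langle x,y_s\mid s\in\mathbb{C}^\times\rangle$, $\mathcal{A}^1_{\mathbb{C}^\times}=\mathbb{Q}+\sum_s\mathcal{A}_{\mathbb{C}^\times}y_s$. For $k_i\ge1$, $s_i\in\mathbb{C}^\times$, $\mathtt{s}^{\mathrm{sh}}_{x^{k_1-1}y_{s_1}\cdots x^{k_n-1}y_{s_n}}(m)=\sum_{m=m_1\ge\cdots\ge m_n\ge0}\frac{s_1^{m_1-m_2}\cdots s_{n-1}^{m_{n-1}-m_n}s_n^{m_n+1}}{(m_1+1)^{k_1}\cdots(m_n+1)^{k_n}}$, extended $\mathbb{Q}$-linearly in the word. $\delta(s)=0$ if $s\in\{0,1\}$, $1$ otherwise. $\iota$ is the algebra automorphism with $\iota(x)=x$, $\iota(y_s)=\delta(s)y_{1-s}-(1-\delta(s))y_1$; $\alpha$ the automorphism with $\alpha(x)=y_1$, $\alpha(y_s)=(1-\delta(s))x+\delta(s)y_s$. $\star$ is the $\mathbb{Q}$-linear map defined on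 words ending in some $y_s$ by $\star(uy_s)=\alpha\iota(u)\,(y_1-\delta(s)y_{1-s})$ for $u\in\mathcal{A}_{\mathbb{C}^\times}$.
   Formalization: The sign in ι is corrected to ι(y_s) = δ(s)y_{1-s} + (1−δ(s))y_1; with the printed minus sign the identity fails for w = y_1y_1, m = 0 (left side 1, right side −1). -}

module Defs where

open import Algebra.Bundles using (CommutativeRing; AbelianGroup)
import Algebra.Construct.DirectProduct as DirectProduct
import Algebra.Properties.Semiring.Exp as Exp
import Algebra.Properties.Semiring.Mult as Mult
open import Algebra.Core using (Op₂)
import Algebra.Consequences.Setoid as Consequences
open import Algebra.Definitions
  using (Associative; Commutative; Congruent₂; LeftIdentity; _DistributesOverˡ_)
import Algebra.Properties.Ring as RingProperties
import Algebra.Solver.Ring.NaturalCoefficients.Default as RingSolver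
open import Data.Integer.Base as ℤ using (ℤ; +_; -[1+_])
open import Data.List.Base as List
  using (List; []; _∷_; [_]; _++_; concatMap; foldr; map; replicate; upTo)
open import Data.Nat.Base as ℕ using (ℕ; zero; suc; _∸_)
open import Data.Nat.Combinatorics using (_C_)
open import Data.Product.Base using (Σ-syntax; ∃; _×_; _,_; proj₁; proj₂)
open import Data.Rational.Base as ℚ using (ℚ; 0ℚ; 1ℚ)
open import Data.Vec.Base as Vec using (Vec; []; _∷_)
open import Function.Base using (_∘_)
open import Level using (Level; _⊔_) renaming (suc to lsuc)
open import Relation.Binary.Core using (Rel)
open import Relation.Binary.Definitions using (tri<; tri≈; tri>)
open import Relation.Binary.PropositionalEquality.Core as ≡ using (_≡_)
import Relation.Binary.Reasoning.Setoid as ≈-Reasoning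
open import Relation.Binary.Structures using (IsStrictTotalOrder)
open import Relation.Nullary using (¬_; Dec; yes; no; contradiction)
open import Relation.Nullary.Decidable using (_×-dec_)
open import Relation.Unary using (Pred)

-- The library has no real numbers.  They are taken as a Dedekind-complete
-- ordered field, which (classically) determines them up to unique
-- isomorphism.  Trichotomy and the total inverse are read classically; the
-- value of 0# ⁻¹ is left unspecified and is never used.
record RealNumbers (c ℓ : Level) : Set (lsuc (c ⊔ ℓ)) where
  infix 4 _<_
  infix 8 _⁻¹
  field
    commutativeRing    : CommutativeRing c ℓ
  open CommutativeRing commutativeRing public
  field
    _⁻¹                : Carrier → Carrier
    inverseʳ           : ∀ x → ¬ x ≈ 0# → x * x ⁻¹ ≈ 1#
    _<_                : Rel Carrier ℓ
    isStrictTotalOrder : IsStrictTotalOrder _≈_ _<_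
    0<1                : 0# < 1#
    +-monoʳ-<          : ∀ x {y z} → y < z → x + y < x + z
    *-pos              : ∀ {x y} → 0# < x → 0# < y → 0# < x * y

  UpperBound : Pred Carrier ℓ → Pred Carrier (c ⊔ ℓ)
  UpperBound P b = ∀ x → P x → ¬ b < x

  field
    supremum           : (P : Pred Carrier ℓ) → ∃ P → ∃ (UpperBound P) →
                         Σ[ b ∈ Carrier ] UpperBound P b ×
                           (∀ b′ → UpperBound P b′ → ¬ b′ < b)

  module Order = IsStrictTotalOrder isStrictTotalOrder

module ComplexNumbers {c ℓ} (ℝ : RealNumbers c ℓ) where

  private
    module R where
      open RealNumbers ℝ public
      open RingProperties ring public

    open RingSolver R.commutativeSemiring

    module R² = AbelianGroup
      (DirectProduct.abelianGroup R.+-abelianGroup R.+-abelianGroup)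

    open R² using () renaming (_≈_ to _≈²_; _∙_ to _+²_)

    _*²_ : Op₂ (R.Carrier × R.Carrier)
    (a , b) *² (a′ , b′) = (a R.* a′ R.- b R.* b′) , (a R.* b′ R.+ b R.* a′)

    1² : R.Carrier × R.Carrier
    1² = R.1# , R.0#

    -- The ring laws are checked for i² = e, with e a variable, because the
    -- solver is for semirings only.
    e : R.Carrier
    e = R.- R.1#

    _*ᵉ_ : Op₂ (R.Carrier × R.Carrier)
    (a , b) *ᵉ (a′ , b′) = (a R.* a′ R.+ e R.* (b R.* b′)) , (a R.* b′ R.+ b R.* a′)

    *²≈*ᵉ : ∀ z w → (z *² w) ≈² (z *ᵉ w)
    *²≈*ᵉ z w = R.+-congˡ (R.sym (R.-1*x≈-x _)) , R.refl

    *²-cong : Congruent₂ _≈²_ _*²_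
    *²-cong (p , q) (p′ , q′) =
      R.+-cong (R.*-cong p p′) (R.-‿cong (R.*-cong q q′)) ,
      R.+-cong (R.*-cong p q′) (R.*-cong q p′)

    *ᵉ-assoc : Associative _≈²_ _*ᵉ_
    *ᵉ-assoc (a , b) (a′ , b′) (a″ , b″) =
      solve 7 (λ e a b a′ b′ a″ b″ →
        (a :* a′ :+ e :* (b :* b′)) :* a″ :+ e :* ((a :* b′ :+ b :* a′) :* b″) :=
        a :* (a′ :* a″ :+ e :* (b′ :* b″)) :+ e :* (b :* (a′ :* b″ :+ b′ :* a″)))
        R.refl e a b a′ b′ a″ b″ ,
      solve 7 (λ e a b a′ b′ a″ b″ →
        (a :* a′ :+ e :* (b :* b′)) :* b″ :+ (a :* b′ :+ b :* a′) :* a″ :=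
        a :* (a′ :* b″ :+ b′ :* a″) :+ b :* (a′ :* a″ :+ e :* (b′ :* b″)))
        R.refl e a b a′ b′ a″ b″

    *²-assoc : Associative _≈²_ _*²_
    *²-assoc z w v = begin
      (z *² w) *² v  ≈⟨ *²-cong (*²≈*ᵉ z w) R².refl ⟩
      (z *ᵉ w) *² v  ≈⟨ *²≈*ᵉ (z *ᵉ w) v ⟩
      (z *ᵉ w) *ᵉ v  ≈⟨ *ᵉ-assoc z w v ⟩
      z *ᵉ (w *ᵉ v)  ≈⟨ *²≈*ᵉ z (w *ᵉ v) ⟨
      z *² (w *ᵉ v)  ≈⟨ *²-cong (R².refl {z}) (*²≈*ᵉ w v) ⟨
      z *² (w *² v)  ∎
      where open ≈-Reasoning R².setoid

    *²-comm : Commutative _≈²_ _*²_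
    *²-comm (a , b) (a′ , b′) =
      R.+-cong (R.*-comm a a′) (R.-‿cong (R.*-comm b b′)) ,
      R.trans (R.+-comm _ _) (R.+-cong (R.*-comm b a′) (R.*-comm a b′))

    *²-identityˡ : LeftIdentity _≈²_ 1² _*²_
    *²-identityˡ z =
      R.trans (R.+-cong (R.*-identityˡ _) (R.trans (R.-‿cong (R.zeroˡ _)) R.-0#≈0#))
        (R.+-identityʳ _) ,
      R.trans (R.+-cong (R.*-identityˡ _) (R.zeroˡ _)) (R.+-identityʳ _)

    *²-distribˡ : _DistributesOverˡ_ _≈²_ _*²_ _+²_
    *²-distribˡ z@(a , b) w@(a′ , b′) v@(a″ , b″) = begin
      z *² (w +² v)              ≈⟨ *²≈*ᵉ z (w +² v) ⟩
      z *ᵉ (w +² v)              ≈⟨ solve 7 (λ e a b a′ b′ a″ b″ →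
                                      a :* (a′ :+ a″) :+ e :* (b :* (b′ :+ b″)) :=
                                      (a :* a′ :+ e :* (b :* b′)) :+
                                      (a :* a″ :+ e :* (b :* b″)))
                                      R.refl e a b a′ b′ a″ b″ ,
                                    solve 6 (λ a b a′ b′ a″ b″ →
                                      a :* (b′ :+ b″) :+ b :* (a′ :+ a″) :=
                                      (a :* b′ :+ b :* a′) :+ (a :* b″ :+ b :* a″))
                                      R.refl a b a′ b′ a″ b″ ⟩
      (z *ᵉ w) +² (z *ᵉ v)       ≈⟨ R².∙-cong (*²≈*ᵉ z w) (*²≈*ᵉ z v) ⟨
      (z *² w) +² (z *² v)       ∎
      where open ≈-Reasoning R².setoid

  -- The pair (a , b) is a + b i.
  complexRing : CommutativeRing c ℓ
  complexRing = record
    { Carrier           = R.Carrier × R.Carrier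
    ; _≈_               = _≈²_
    ; _+_               = _+²_
    ; _*_               = _*²_
    ; -_                = R²._⁻¹
    ; 0#                = R².ε
    ; 1#                = 1²
    ; isCommutativeRing = record
      { isRing = record
        { +-isAbelianGroup = R².isAbelianGroup
        ; *-cong           = *²-cong
        ; *-assoc          = *²-assoc
        ; *-identity       = comm∧idˡ⇒id *²-comm *²-identityˡ
        ; distrib          = comm∧distrˡ⇒distr R².∙-cong *²-comm *²-distribˡ
        }
      ; *-comm = *²-comm
      }
    }
    where open Consequences R².setoid

  open CommutativeRing complexRing public
    renaming (Carrier to ℂ)

  infix 4 _≟_
  _≟_ : (z w : ℂ) → Dec (z ≈ w)
  (a , b) ≟ (a′ , b′) = (a R.Order.≟ a′) ×-dec (b R.Order.≟ b′)

  infix 8 _⁻¹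
  _⁻¹ : ℂ → ℂ
  (a , b) ⁻¹ = a R.* N R.⁻¹ , R.- b R.* N R.⁻¹
    where N = a R.* a R.+ b R.* b

  1≉0 : ¬ 1# ≈ 0#
  1≉0 (p , _) = R.Order.irrefl (R.sym p) R.0<1

  private
    +-pos : ∀ {x y} → R.0# R.< x → R.0# R.< y → R.0# R.< x R.+ y
    +-pos {x} {y} p q = R.Order.trans p
      (R.Order.<-respˡ-≈ (R.+-identityʳ x) (R.+-monoʳ-< x q))

    neg-pos : ∀ {x} → x R.< R.0# → R.0# R.< R.- x
    neg-pos {x} p = R.Order.<-respˡ-≈ (R.-‿inverseˡ x)
      (R.Order.<-respʳ-≈ (R.+-identityʳ (R.- x)) (R.+-monoʳ-< (R.- x) p))

    -x*-y≈x*y : ∀ x y → R.- x R.* R.- y R.≈ x R.* y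
    -x*-y≈x*y x y = R.trans (R.sym (R.-‿distribˡ-* x (R.- y)))
      (R.trans (R.-‿cong (R.sym (R.-‿distribʳ-* x y))) (R.-‿involutive _))

    square-pos : ∀ x → ¬ x R.≈ R.0# → R.0# R.< x R.* x
    square-pos x x≉0 with R.Order.compare x R.0#
    ... | tri< x<0 _ _ = R.Order.<-respʳ-≈
                           (-x*-y≈x*y x x)
                           (R.*-pos (neg-pos x<0) (neg-pos x<0))
    ... | tri≈ _ x≈0 _ = contradiction x≈0 x≉0
    ... | tri> _ _ 0<x = R.*-pos 0<x 0<x

    norm≉0 : ∀ a b → ¬ (a , b) ≈ 0# → ¬ a R.* a R.+ b R.* b R.≈ R.0#
    norm≉0 a b z≉0 N≈0 with a R.Order.≟ R.0# | b R.Order.≟ R.0#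
    ... | yes a≈0 | yes b≈0 = z≉0 (a≈0 , b≈0)
    ... | yes a≈0 | no  b≉0 = R.Order.irrefl (R.sym (R.trans (R.sym
            (R.trans (R.+-congʳ (R.trans (R.*-congʳ a≈0) (R.zeroˡ a))) (R.+-identityˡ _)))
            N≈0)) (square-pos b b≉0)
    ... | no  a≉0 | yes b≈0 = R.Order.irrefl (R.sym (R.trans (R.sym
            (R.trans (R.+-congˡ (R.trans (R.*-congʳ b≈0) (R.zeroˡ b))) (R.+-identityʳ _)))
            N≈0)) (square-pos a a≉0)
    ... | no  a≉0 | no  b≉0 = R.Order.irrefl (R.sym N≈0)
            (+-pos (square-pos a a≉0) (square-pos b b≉0))

  inverseʳ : ∀ z → ¬ z ≈ 0# → z * z ⁻¹ ≈ 1#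
  inverseʳ (a , b) z≉0 =
    R.trans (R.+-cong (R.sym (R.*-assoc a a n))
              (R.trans (R.-‿distribʳ-* b _) (R.trans (R.*-congˡ (R.-‿distribˡ-* (R.- b) n))
                (R.trans (R.*-congˡ (R.*-congʳ (R.-‿involutive b))) (R.sym (R.*-assoc b b n))))))
      (R.trans (R.sym (R.distribʳ n _ _)) (R.inverseʳ _ (norm≉0 a b z≉0))) ,
    R.trans (R.+-congʳ (R.trans (R.*-congˡ (R.sym (R.-‿distribˡ-* b n)))
              (R.sym (R.-‿distribʳ-* a _))))
      (R.trans (R.+-congˡ (solve 3 (λ a b n → b :* (a :* n) := a :* (b :* n)) R.refl a b n))
        (R.-‿inverseˡ _))
    where n = (a R.* a R.+ b R.* b) R.⁻¹

  open Exp semiring public using (_^_)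
  open Mult semiring public using () renaming (_×_ to _×′_)

  fromℕ : ℕ → ℂ
  fromℕ n = n ×′ 1#

  fromℤ : ℤ → ℂ
  fromℤ (+ n)    = fromℕ n
  fromℤ -[1+ n ] = - fromℕ (suc n)

  fromℚ : ℚ → ℂ
  fromℚ q = fromℤ (ℚ.↥ q) * fromℤ (ℚ.↧ q) ⁻¹

  ∑ : ∀ {a} {A : Set a} → List A → (A → ℂ) → ℂ
  ∑ as f = foldr (λ a z → f a + z) 0# as

  ℂˣ : Set (c ⊔ ℓ)
  ℂˣ = Σ[ s ∈ ℂ ] ¬ s ≈ 0#

  1ˣ : ℂˣ
  1ˣ = 1# , 1≉0

  1-_[_] : (s : ℂ) → ¬ s ≈ 1# → ℂˣ
  1- s [ s≉1 ] = 1# - s , λ 1-s≈0 →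
    s≉1 (sym (RingProperties.x∙y⁻¹≈ε⇒x≈y ring 1# s 1-s≈0))

-- Finite formal ℚ-linear combinations, as unreduced lists of terms.
Lin : ∀ {b} → Set b → Set b
Lin B = List (ℚ × B)

module _ {b} {B : Set b} where

  ⟨_⟩ : B → Lin B
  ⟨ b ⟩ = [ 1ℚ , b ]

  infixr 7 _•_
  _•_ : ℚ → Lin B → Lin B
  q • u = map (λ (r , b) → q ℚ.* r , b) u

  infixl 6 _⊞_ _⊟_
  _⊞_ _⊟_ : Lin B → Lin B → Lin B
  u ⊞ v = u ++ v
  u ⊟ v = u ⊞ (ℚ.- 1ℚ) • v

linear : ∀ {a b} {A : Set a} {B : Set b} → (A → Lin B) → Lin A → Lin B
linear f = concatMap (λ (q , a) → q • f a)

bilinear : ∀ {a b c} {A : Set a} {B : Set b} {C : Set c} →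
           (A → B → C) → Lin A → Lin B → Lin C
bilinear h u v = linear (λ a → linear (λ b → ⟨ h a b ⟩) v) u

module Words {c ℓ} (ℝ : RealNumbers c ℓ) where

  open ComplexNumbers ℝ public

  data Letter : Set (c ⊔ ℓ) where
    x : Letter
    y : ℂˣ → Letter

  Word : Set (c ⊔ ℓ)
  Word = List Letter

  𝒜 : Set (c ⊔ ℓ)
  𝒜 = Lin Word

  infixl 7 _·_
  _·_ : 𝒜 → 𝒜 → 𝒜
  _·_ = bilinear _++_

  algebraHom : (Letter → 𝒜) → 𝒜 → 𝒜
  algebraHom g = linear (foldr (λ l u → g l · u) ⟨ [] ⟩)

  -- The pair (u , s) is the word u y_s, so that 𝒜y is ⊕_s 𝒜 y_s, the
  -- complement of ℚ in 𝒜¹.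
  Wordy : Set (c ⊔ ℓ)
  Wordy = Word × ℂˣ

  𝒜y : Set (c ⊔ ℓ)
  𝒜y = Lin Wordy

  -- Multiplication by a combination of the y_s, itself given in Lin ℂˣ.
  infixl 7 _·y_
  _·y_ : 𝒜 → Lin ℂˣ → 𝒜y
  _·y_ = bilinear _,_

  letters : Lin ℂˣ → 𝒜
  letters = linear (λ s → ⟨ [ y s ] ⟩)

  δ : ℂ → ℚ
  δ s with s ≟ 0# | s ≟ 1#
  ... | yes _ | _     = 0ℚ
  ... | no  _ | yes _ = 0ℚ
  ... | no  _ | no  _ = 1ℚ

  -- y_{1-s}, which is not a generator for s = 1; it then only occurs
  -- multiplied by δ(1) = 0, and any value would do.
  y₁₋ : ℂˣ → Lin ℂˣ
  y₁₋ (s , _) with s ≟ 1#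
  ... | yes _   = []
  ... | no  s≉1 = ⟨ 1- s [ s≉1 ] ⟩

  -- ι fixes y₁.  The source prints ι(y_s) = δ(s) y_{1-s} − (1−δ(s)) y₁, hence
  -- ι(y₁) = −y₁.  That sign is a misprint: it gives ⋆(y₁y₁) = −x y₁, whose
  -- sequence is −1 at m = 0, whereas ∇ sˢʰ_{y₁y₁} is 1 there.
  ι : 𝒜 → 𝒜
  ι = algebraHom λ where
    x             → ⟨ [ x ] ⟩
    (y s@(z , _)) → letters (δ z • y₁₋ s ⊞ (1ℚ ℚ.- δ z) • ⟨ 1ˣ ⟩)

  α : 𝒜 → 𝒜
  α = algebraHom λ where
    x             → ⟨ [ y 1ˣ ] ⟩
    (y s@(z , _)) → (1ℚ ℚ.- δ z) • ⟨ [ x ] ⟩ ⊞ δ z • ⟨ [ y s ] ⟩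

  ⋆ : 𝒜y → 𝒜y
  ⋆ = linear λ (u , s) → α (ι ⟨ u ⟩) ·y (⟨ 1ˣ ⟩ ⊟ δ (proj₁ s) • y₁₋ s)

  -- (k-1 , s) encodes x^{k-1} y_s, so every exponent k is positive.
  record Block : Set (c ⊔ ℓ) where
    constructor _,_
    field
      k-1 : ℕ
      s   : ℂˣ

    k : ℕ
    k = suc k-1

  open Block

  -- x^{k₁-1} y_{s₁} ⋯ x^{kₙ-1} y_{sₙ}
  word : ∀ {n} → Vec Block (suc n) → Wordy
  word (b ∷ [])        = replicate (k-1 b) x , s b
  word (b ∷ bs@(_ ∷ _)) =
    replicate (k-1 b) x ++ y (s b) ∷ proj₁ (word bs) , proj₂ (word bs)

  Blocks : Set (c ⊔ ℓ)
  Blocks = Σ[ n ∈ ℕ ] Vec Block (suc n)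

  prependX : Blocks → Blocks
  prependX (n , (j , s) ∷ bs) = n , (suc j , s) ∷ bs

  prependY : ℂˣ → Blocks → Blocks
  prependY s (n , bs) = suc n , (0 , s) ∷ bs

  blocks : Wordy → Blocks
  blocks (u , s) = go u
    where
    go : Word → Blocks
    go []        = 0 , (0 , s) ∷ []
    go (x   ∷ u) = prependX (go u)
    go (y t ∷ u) = prependY t (go u)

  blocks-word : ∀ {n} (bs : Vec Block (suc n)) → blocks (word bs) ≡ (n , bs)
  blocks-word ((zero  , s) ∷ []) = ≡.refl
  blocks-word ((suc j , s) ∷ []) = ≡.cong prependX (blocks-word ((j , s) ∷ []))
  blocks-word ((zero  , s) ∷ bs@(_ ∷ _)) =
    ≡.cong (prependY s) (blocks-word bs)
  blocks-word ((suc j , s) ∷ bs@(_ ∷ _)) =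
    ≡.cong prependX (blocks-word ((j , s) ∷ bs))

  -- The tuples (m₁, …, mₙ) with m = m₁ ≥ ⋯ ≥ mₙ ≥ 0, where the length is suc n.
  chains : (n m : ℕ) → List (Vec ℕ (suc n))
  chains zero    m = [ m ∷ [] ]
  chains (suc n) m = map (m ∷_) (concatMap (chains n) (upTo (suc m)))

  -- s₁^{m₁-m₂} ⋯ s_{n-1}^{m_{n-1}-mₙ} sₙ^{mₙ+1}; ∸ is exact on chains.
  numerator : ∀ {n} → Vec Block (suc n) → Vec ℕ (suc n) → ℂ
  numerator (b ∷ [])         (m ∷ [])           = proj₁ (s b) ^ (suc m)
  numerator (b ∷ bs@(_ ∷ _)) (m ∷ ms@(m′ ∷ _)) =
    proj₁ (s b) ^ (m ∸ m′) * numerator bs ms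

  denominator : ∀ {n} → Vec Block n → Vec ℕ n → ℂ
  denominator []       []       = 1#
  denominator (b ∷ bs) (m ∷ ms) = fromℕ (suc m) ^ k b * denominator bs ms

  sˢʰ-word : Wordy → ℕ → ℂ
  sˢʰ-word w m = ∑ (chains (proj₁ bs) m) λ ms →
    numerator (proj₂ bs) ms * denominator (proj₂ bs) ms ⁻¹
    where bs = blocks w

  sˢʰ : 𝒜y → ℕ → ℂ
  sˢʰ v m = ∑ v λ (q , w) → fromℚ q * sˢʰ-word w m

  ∇ : (ℕ → ℂ) → ℕ → ℂ
  ∇ a m = ∑ (upTo (suc m)) λ i → (- 1#) ^ i * fromℕ (m C i) * a i

{-# OPTIONS --safe #-}
module Submission where

-- Prepending y_z to a word turns its sequence a into
--   (Y z a)(m) = (m+1)⁻¹ ∑_{j ≤ m} z^{m-j} a(j),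
-- and prepending x is the same operation for z = 0.  Since t(i) = i (Y z a)(i-1)
-- solves t(i+1) = z t(i) + a(i), and ∇ carries the shift E to 1 − E, one gets
-- ∇ ∘ Y z = Y (1 − z) ∘ ∇.  On letters α ∘ ι is exactly the substitution
-- z ↦ 1 − z (x ↔ y₁, y_s ↦ y_{1-s}), and on one-letter words ∇ gives
-- (1 − (1−s)^{m+1}) / (m+1), the sequence of y₁ − δ(s) y_{1-s}.

import Algebra.Properties.CommutativeSemigroup as CommutativeSemigroupProperties
import Algebra.Properties.Ring as RingProperties
import Algebra.Properties.Semiring.Exp as Exp
import Algebra.Properties.Semiring.Mult as Mult
import Algebra.Solver.Ring.NaturalCoefficients.Default as RingSolver
open import Data.Integer.Base as ℤ using (-[1+_])
import Data.Integer.Properties as ℤ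
open import Data.List.Base
  using (List; []; _∷_; [_]; _++_; concatMap; foldr; map; upTo)
import Data.List.Properties as List
open import Data.Nat.Base as ℕ using (ℕ; zero; suc; _∸_)
open import Data.Nat.Combinatorics using (_C_; nCk+nC[k+1]≡[n+1]C[k+1]; k>n⇒nCk≡0)
import Data.Nat.Properties as ℕ
open import Data.Product.Base using (_,_; proj₁; proj₂)
open import Data.Rational.Base as ℚ using (ℚ; 0ℚ; 1ℚ)
import Data.Rational.Properties as ℚ
import Data.Rational.Unnormalised.Base as ℚᵘ
open import Data.Vec.Base using (Vec; []; _∷_)
open import Function.Base using (_∘_)
open import Level using (_⊔_)
open import Relation.Binary.PropositionalEquality.Core as ≡ using (_≡_)
import Relation.Binary.Reasoning.Setoid as ≈-Reasoning
open import Relation.Nullary using (¬_; Dec; yes; no; contradiction)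

open import Defs

-- Two minus signs cancel in the passage from z to 1 - z. The rule E∇ = ∇(1 - E) turns the source a
-- of the recurrence for t into -∇a, and binomial absorption gives ∇t(m+1) = -(m+1) ∇(Y z a)(m).
-- Signed identities are stated as sums, often equal to zero, so that most steps are identities of a
-- commutative semiring.
--
-- On the algebraic side the obstacle is that a letter is sent to a linear combination: the image of
-- a word is not a word, and no induction can run along it. Instead, a family of sequences indexed
-- by words is pulled back along the substitution. The property that survives is that a letter put
-- in front acts by `Y` with a parameter depending only on that letter, so the induction stays on
-- the source word.

-- Finite sums and the recurrence of the binomial transform.

module Sums {c ℓ} (ℝ : RealNumbers c ℓ) where

  open Words ℝ
  open ≈-Reasoning setoid
  open RingSolver commutativeSemiring
  open CommutativeSemigroupProperties +-commutativeSemigroup using ()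
    renaming (interchange to +-interchange)

  ∑-cong : ∀ {a} {A : Set a} (as : List A) {f g : A → ℂ} →
           (∀ a → f a ≈ g a) → ∑ as f ≈ ∑ as g
  ∑-cong []       f≈g = refl
  ∑-cong (a ∷ as) f≈g = +-cong (f≈g a) (∑-cong as f≈g)

  ∑-++ : ∀ {a} {A : Set a} (as bs : List A) (f : A → ℂ) →
         ∑ (as ++ bs) f ≈ ∑ as f + ∑ bs f
  ∑-++ []       bs f = sym (+-identityˡ _)
  ∑-++ (a ∷ as) bs f = trans (+-congˡ (∑-++ as bs f)) (sym (+-assoc _ _ _))

  ∑-map : ∀ {a b} {A : Set a} {B : Set b} (h : A → B) (as : List A) (f : B → ℂ) →
          ∑ (map h as) f ≡ ∑ as (f ∘ h)
  ∑-map h []       f = ≡.refl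
  ∑-map h (a ∷ as) f = ≡.cong (f (h a) +_) (∑-map h as f)

  ∑-concatMap : ∀ {a b} {A : Set a} {B : Set b} (h : A → List B) (as : List A)
                (f : B → ℂ) → ∑ (concatMap h as) f ≈ ∑ as (λ a → ∑ (h a) f)
  ∑-concatMap h []       f = refl
  ∑-concatMap h (a ∷ as) f =
    trans (∑-++ (h a) (concatMap h as) f) (+-congˡ (∑-concatMap h as f))

  ∑-distribˡ : ∀ {a} {A : Set a} (as : List A) (z : ℂ) (f : A → ℂ) →
               ∑ as (λ a → z * f a) ≈ z * ∑ as f
  ∑-distribˡ []       z f = sym (zeroʳ z)
  ∑-distribˡ (a ∷ as) z f =
    trans (+-congˡ (∑-distribˡ as z f)) (sym (distribˡ z _ _))

  ∑-distribʳ : ∀ {a} {A : Set a} (as : List A) (z : ℂ) (f : A → ℂ) →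
               ∑ as (λ a → f a * z) ≈ ∑ as f * z
  ∑-distribʳ as z f = begin
    ∑ as (λ a → f a * z)  ≈⟨ ∑-cong as (λ a → *-comm (f a) z) ⟩
    ∑ as (λ a → z * f a)  ≈⟨ ∑-distribˡ as z f ⟩
    z * ∑ as f            ≈⟨ *-comm z (∑ as f) ⟩
    ∑ as f * z            ∎

  ∑-+ : ∀ {a} {A : Set a} (as : List A) (f g : A → ℂ) →
        ∑ as (λ a → f a + g a) ≈ ∑ as f + ∑ as g
  ∑-+ []       f g = sym (+-identityˡ 0#)
  ∑-+ (a ∷ as) f g = trans (+-congˡ (∑-+ as f g)) (+-interchange _ _ _ _)

  ∑-upTo-first : ∀ n (f : ℕ → ℂ) → ∑ (upTo (suc n)) f ≡ f 0 + ∑ (upTo n) (f ∘ suc)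
  ∑-upTo-first n f = ≡.cong (f 0 +_) (≡.trans
    (≡.cong (λ l → ∑ l f) (≡.sym (List.map-upTo suc n)))
    (∑-map suc (upTo n) f))

  ∑-upTo-last : ∀ n (f : ℕ → ℂ) → ∑ (upTo (suc n)) f ≈ ∑ (upTo n) f + f n
  ∑-upTo-last n f = begin
    ∑ (upTo (suc n)) f          ≡⟨ ≡.cong (λ l → ∑ l f) (List.upTo-∷ʳ n) ⟨
    ∑ (upTo n ++ [ n ]) f       ≈⟨ ∑-++ (upTo n) [ n ] f ⟩
    ∑ (upTo n) f + (f n + 0#)   ≈⟨ +-congˡ (+-identityʳ (f n)) ⟩
    ∑ (upTo n) f + f n          ∎

  ∇-cong : ∀ {a b : ℕ → ℂ} → (∀ i → a i ≈ b i) → ∀ m → ∇ a m ≈ ∇ b m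
  ∇-cong a≈b m = ∑-cong (upTo (suc m)) λ i → *-congˡ (a≈b i)

  ∇-+ : ∀ (a b : ℕ → ℂ) m → ∇ (λ i → a i + b i) m ≈ ∇ a m + ∇ b m
  ∇-+ a b m = trans
    (∑-cong (upTo (suc m)) λ i → distribˡ _ (a i) (b i))
    (∑-+ (upTo (suc m)) _ _)

  ∇-*ˡ : ∀ z (a : ℕ → ℂ) m → ∇ (λ i → z * a i) m ≈ z * ∇ a m
  ∇-*ˡ z a m = trans
    (∑-cong (upTo (suc m)) λ i → solve 3 (λ p z a → p :* (z :* a) := z :* (p :* a))
      refl _ z (a i))
    (∑-distribˡ (upTo (suc m)) z _)

  fromℕ-+ : ∀ m n → fromℕ (m ℕ.+ n) ≈ fromℕ m + fromℕ n
  fromℕ-+ m n = Mult.×-homo-+ semiring 1# m n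

  ∇-zero : ∀ a → ∇ a 0 ≈ a 0
  ∇-zero a = begin
    1# * (1# + 0#) * a 0 + 0#  ≈⟨ solve 1 (λ a → con 1 :* (con 1 :+ con 0) :* a :+ con 0 := a) refl (a 0) ⟩
    a 0                        ∎

  -- The recurrence ∇a(m+1) = ∇a(m) − ∇(Ea)(m) for the shift E, as a semiring
  -- identity.
  ∇-suc : ∀ a m → ∇ a (suc m) + ∇ (a ∘ suc) m ≈ ∇ a m
  ∇-suc a m = begin
    ∇ a (suc m) + ∇ (a ∘ suc) m
      ≡⟨ ≡.cong (_+ ∇ (a ∘ suc) m) (∑-upTo-first (suc m) (λ i → e i * fromℕ (suc m C i) * a i)) ⟩
    t 0 + ∑ (upTo (suc m)) (λ i → e (suc i) * fromℕ (suc m C suc i) * a (suc i)) + ∇ (a ∘ suc) m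
      ≈⟨ +-assoc _ _ _ ⟩
    t 0 + (∑ (upTo (suc m)) (λ i → e (suc i) * fromℕ (suc m C suc i) * a (suc i)) + ∇ (a ∘ suc) m)
      ≈⟨ +-congˡ (∑-+ (upTo (suc m)) _ _) ⟨
    t 0 + ∑ (upTo (suc m)) (λ i → e (suc i) * fromℕ (suc m C suc i) * a (suc i)
                                  + e i * fromℕ (m C i) * a (suc i))
      ≈⟨ +-congˡ (∑-cong (upTo (suc m)) pascal) ⟩
    t 0 + ∑ (upTo (suc m)) (t ∘ suc)
      ≡⟨ ∑-upTo-first (suc m) t ⟨
    ∑ (upTo (suc (suc m))) t
      -- The sum now runs one index past that of `∇ a m`; the extra term contains C(m, m+1) = 0.
      ≈⟨ ∑-upTo-last (suc m) t ⟩
    ∇ a m + t (suc m)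
      ≈⟨ +-congˡ (*-congʳ (*-congˡ (reflexive (≡.cong fromℕ (k>n⇒nCk≡0 (ℕ.n<1+n m)))))) ⟩
    ∇ a m + e (suc m) * 0# * a (suc m)
      ≈⟨ solve 3 (λ s e a → s :+ e :* con 0 :* a := s) refl (∇ a m) (e (suc m)) (a (suc m)) ⟩
    ∇ a m ∎
    where
    e : ℕ → ℂ
    e i = (- 1#) ^ i

    t : ℕ → ℂ
    t i = e i * fromℕ (m C i) * a i

    pascal : ∀ i → e (suc i) * fromℕ (suc m C suc i) * a (suc i)
                   + e i * fromℕ (m C i) * a (suc i) ≈ t (suc i)
    pascal i = begin
      e (suc i) * fromℕ (suc m C suc i) * b + e i * p * b
        ≈⟨ +-congʳ (*-congʳ (*-congˡ (trans
             (reflexive (≡.cong fromℕ (≡.sym (nCk+nC[k+1]≡[n+1]C[k+1] m i))))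
             (fromℕ-+ (m C i) (m C suc i))))) ⟩
      - 1# * e i * (p + q) * b + e i * p * b
        ≈⟨ solve 5 (λ u e p q b → u :* e :* (p :+ q) :* b :+ e :* p :* b :=
                                  u :* e :* q :* b :+ (u :+ con 1) :* (e :* p :* b))
             refl (- 1#) (e i) p q b ⟩
      - 1# * e i * q * b + (- 1# + 1#) * (e i * p * b)
        ≈⟨ +-congˡ (trans (*-congʳ (-‿inverseˡ 1#)) (zeroˡ _)) ⟩
      - 1# * e i * q * b + 0#
        ≈⟨ +-identityʳ _ ⟩
      t (suc i) ∎
      where
      p = fromℕ (m C i)
      q = fromℕ (m C suc i)
      b = a (suc i)

-- The operators `Y z` and their behaviour under `∇`.

module Transform {c ℓ} (ℝ : RealNumbers c ℓ) where

  open Words ℝ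
  open Sums ℝ
  open ≈-Reasoning setoid
  open RingSolver commutativeSemiring
  open RingProperties ring

  private
    module R = RealNumbers ℝ

  fromℕ≉0 : ∀ n → ¬ fromℕ (suc n) ≈ 0#
  fromℕ≉0 n (p , _) = R.Order.irrefl (R.sym p) (positive n)
    where
    1+-pos : ∀ {a} → R.0# R.< a → R.0# R.< R.1# R.+ a
    1+-pos 0<a = R.Order.trans R.0<1
      (R.Order.<-respˡ-≈ (R.+-identityʳ R.1#) (R.+-monoʳ-< R.1# 0<a))

    positive : ∀ n → R.0# R.< proj₁ (fromℕ (suc n))
    positive zero    = R.Order.<-respʳ-≈ (R.sym (R.+-identityʳ R.1#)) R.0<1
    positive (suc n) = 1+-pos (positive n)

  *-cancelˡ : ∀ {z} → ¬ z ≈ 0# → ∀ {u v} → z * u ≈ z * v → u ≈ v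
  *-cancelˡ {z} z≉0 {u} {v} zu≈zv = begin
    u                ≈⟨ shuffle u ⟩
    z * u * z ⁻¹     ≈⟨ *-congʳ zu≈zv ⟩
    z * v * z ⁻¹     ≈⟨ shuffle v ⟨
    v                ∎
    where
    shuffle : ∀ u → u ≈ z * u * z ⁻¹
    shuffle u = begin
      u                ≈⟨ *-identityˡ u ⟨
      1# * u           ≈⟨ *-congʳ (inverseʳ z z≉0) ⟨
      z * z ⁻¹ * u     ≈⟨ solve 3 (λ z i u → z :* i :* u := z :* u :* i) refl z (z ⁻¹) u ⟩
      z * u * z ⁻¹     ∎

  ⁻¹-unique : ∀ {z w} → ¬ z ≈ 0# → z * w ≈ 1# → w ≈ z ⁻¹
  ⁻¹-unique {z} z≉0 zw≈1 = *-cancelˡ z≉0 (trans zw≈1 (sym (inverseʳ z z≉0)))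

  *-≉0 : ∀ {z w} → ¬ z ≈ 0# → ¬ w ≈ 0# → ¬ z * w ≈ 0#
  *-≉0 {z} z≉0 w≉0 zw≈0 = w≉0 (*-cancelˡ z≉0 (trans zw≈0 (sym (zeroʳ z))))

  ^-≉0 : ∀ {z} → ¬ z ≈ 0# → ∀ n → ¬ z ^ n ≈ 0#
  ^-≉0 z≉0 zero    = 1≉0
  ^-≉0 z≉0 (suc n) = *-≉0 z≉0 (^-≉0 z≉0 n)

  ⁻¹-cong : ∀ {z w} → ¬ z ≈ 0# → z ≈ w → z ⁻¹ ≈ w ⁻¹
  ⁻¹-cong {z} z≉0 z≈w =
    ⁻¹-unique (λ w≈0 → z≉0 (trans z≈w w≈0)) (trans (*-congʳ (sym z≈w)) (inverseʳ z z≉0))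

  ⁻¹-distrib-* : ∀ {z w} → ¬ z ≈ 0# → ¬ w ≈ 0# → (z * w) ⁻¹ ≈ z ⁻¹ * w ⁻¹
  ⁻¹-distrib-* {z} {w} z≉0 w≉0 = sym (⁻¹-unique (*-≉0 z≉0 w≉0) (begin
    z * w * (z ⁻¹ * w ⁻¹)
      ≈⟨ solve 4 (λ z w i j → z :* w :* (i :* j) := z :* i :* (w :* j)) refl z w (z ⁻¹) (w ⁻¹) ⟩
    z * z ⁻¹ * (w * w ⁻¹)
      ≈⟨ *-cong (inverseʳ z z≉0) (inverseʳ w w≉0) ⟩
    1# * 1#
      ≈⟨ *-identityˡ 1# ⟩
    1# ∎))

  recip : ℕ → ℂ
  recip m = fromℕ (suc m) ⁻¹

  -- Prepending x is the case z = 0 because 0⁰ = 1.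
  T : ℂ → (ℕ → ℂ) → ℕ → ℂ
  T z a m = ∑ (upTo (suc m)) λ j → z ^ (m ∸ j) * a j

  Y : ℂ → (ℕ → ℂ) → ℕ → ℂ
  Y z a m = T z a m * recip m

  T-zero : ∀ z a → T z a 0 ≈ a 0
  T-zero z a = trans (+-identityʳ _) (*-identityˡ (a 0))

  T-first : ∀ z a m → T z a (suc m) ≡ z ^ suc m * a 0 + T z (a ∘ suc) m
  T-first z a m = ∑-upTo-first (suc m) (λ j → z ^ (suc m ∸ j) * a j)

  -- The induction peels off the first term and shifts the sequence, because `suc m ∸ suc j` reduces
  -- to `m ∸ j`, whereas `suc m ∸ j` is stuck for a variable `j`.
  T-suc : ∀ z a m → T z a (suc m) ≈ z * T z a m + a (suc m)
  T-suc z a zero    = solve 3 (λ z a b →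
      z :* con 1 :* a :+ (con 1 :* b :+ con 0) := z :* (con 1 :* a :+ con 0) :+ b)
    refl z (a 0) (a 1)
  T-suc z a (suc m) = begin
    T z a (suc (suc m))
      ≡⟨ T-first z a (suc m) ⟩
    z * z ^ suc m * a 0 + T z (a ∘ suc) (suc m)
      ≈⟨ +-congˡ (T-suc z (a ∘ suc) m) ⟩
    z * z ^ suc m * a 0 + (z * T z (a ∘ suc) m + a (suc (suc m)))
      ≈⟨ solve 5 (λ z p a t b → z :* p :* a :+ (z :* t :+ b) := z :* (p :* a :+ t) :+ b)
           refl z (z ^ suc m) (a 0) (T z (a ∘ suc) m) (a (suc (suc m))) ⟩
    z * (z ^ suc m * a 0 + T z (a ∘ suc) m) + a (suc (suc m))
      ≡⟨ ≡.cong (λ t → z * t + a (suc (suc m))) (T-first z a m) ⟨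
    z * T z a (suc m) + a (suc (suc m)) ∎

  T-cong : ∀ {z w} {a b : ℕ → ℂ} → z ≈ w → (∀ j → a j ≈ b j) → ∀ m → T z a m ≈ T w b m
  T-cong z≈w a≈b m =
    ∑-cong (upTo (suc m)) λ j → *-cong (Exp.^-congˡ semiring (m ∸ j) z≈w) (a≈b j)

  Y-cong : ∀ {z w} {a b : ℕ → ℂ} → z ≈ w → (∀ j → a j ≈ b j) → ∀ m → Y z a m ≈ Y w b m
  Y-cong z≈w a≈b m = *-congʳ (T-cong z≈w a≈b m)

  Y-congʳ : ∀ {z w} → z ≈ w → ∀ a m → Y z a m ≈ Y w a m
  Y-congʳ z≈w a = Y-cong z≈w (λ _ → refl)

  T-∑ : ∀ {b} {B : Set b} (bs : List B) z (a : B → ℕ → ℂ) m →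
        T z (λ j → ∑ bs λ b → a b j) m ≈ ∑ bs λ b → T z (a b) m
  T-∑ []       z a m = trans
    (∑-distribʳ (upTo (suc m)) 0# (λ j → z ^ (m ∸ j)))
    (zeroʳ _)
  T-∑ (b ∷ bs) z a m = begin
    T z (λ j → a b j + ∑ bs λ b → a b j) m
      ≈⟨ ∑-cong (upTo (suc m)) (λ j → distribˡ _ _ _) ⟩
    ∑ (upTo (suc m)) (λ j → z ^ (m ∸ j) * a b j + z ^ (m ∸ j) * ∑ bs λ b → a b j)
      ≈⟨ ∑-+ (upTo (suc m)) _ _ ⟩
    T z (a b) m + T z (λ j → ∑ bs λ b → a b j) m
      ≈⟨ +-congˡ (T-∑ bs z a m) ⟩
    T z (a b) m + ∑ bs (λ b → T z (a b) m) ∎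

  T-*ˡ : ∀ z q a m → T z (λ j → q * a j) m ≈ q * T z a m
  T-*ˡ z q a m = trans
    (∑-cong (upTo (suc m)) λ j → solve 3 (λ p q a → p :* (q :* a) := q :* (p :* a))
      refl _ q (a j))
    (∑-distribˡ (upTo (suc m)) q _)

  Y-0# : ∀ a m → Y 0# a m ≈ a m * recip m
  Y-0# a zero    = *-congʳ (T-zero 0# a)
  Y-0# a (suc m) = *-congʳ (begin
    T 0# a (suc m)              ≈⟨ T-suc 0# a m ⟩
    0# * T 0# a m + a (suc m)   ≈⟨ +-congʳ (zeroˡ _) ⟩
    0# + a (suc m)              ≈⟨ +-identityˡ _ ⟩
    a (suc m)                   ∎)

  S : (ℕ → ℂ) → ℕ → ℂ
  S a zero    = 0#
  S a (suc m) = fromℕ (suc m) * a m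

  -- Binomial absorption (m+1) C(m,i) = (i+1) C(m+1,i+1), proved from the
  -- recurrence of ∇ by means of ESc = SEc + c.
  ∇-S : ∀ a m → fromℕ (suc m) * ∇ a m + ∇ (S a) (suc m) ≈ 0#
  ∇-S a zero = begin
    fromℕ 1 * ∇ a 0 + ∇ (S a) 1
      ≈⟨ +-congʳ (*-congˡ (trans (∇-zero a) (sym a≈))) ⟩
    fromℕ 1 * ∇ (S a ∘ suc) 0 + ∇ (S a) 1
      ≈⟨ solve 2 (λ t u → (con 1 :+ con 0) :* t :+ u := u :+ t) refl (∇ (S a ∘ suc) 0) (∇ (S a) 1) ⟩
    ∇ (S a) 1 + ∇ (S a ∘ suc) 0
      ≈⟨ ∇-suc (S a) 0 ⟩
    ∇ (S a) 0
      ≈⟨ ∇-zero (S a) ⟩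
    0# ∎
    where
    a≈ : ∇ (S a ∘ suc) 0 ≈ a 0
    a≈ = trans (∇-zero (S a ∘ suc))
      (solve 1 (λ a → (con 1 :+ con 0) :* a := a) refl (a 0))
  ∇-S a (suc m) = begin
    fromℕ (suc (suc m)) * d + s″
      ≈⟨ solve 3 (λ n d s → (con 1 :+ n) :* d :+ s := n :* d :+ (s :+ d)) refl n d s″ ⟩
    n * d + (s″ + d)
      ≈⟨ +-identityʳ _ ⟨
    n * d + (s″ + d) + 0#
      -- The induction hypothesis is used for two sequences: here for `a ∘ suc`, inserted as a zero
      -- so that `d′` can join `d` in `∇-suc`, and in the last step for `a` itself.
      ≈⟨ +-congˡ (∇-S (a ∘ suc) m) ⟨
    n * d + (s″ + d) + (n * d′ + ∇ (S (a ∘ suc)) (suc m))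
      ≈⟨ solve 5 (λ n d s d′ s′ → n :* d :+ (s :+ d) :+ (n :* d′ :+ s′) :=
                                  n :* (d :+ d′) :+ (s :+ (s′ :+ d)))
           refl n d s″ d′ (∇ (S (a ∘ suc)) (suc m)) ⟩
    n * (d + d′) + (s″ + (∇ (S (a ∘ suc)) (suc m) + d))
      ≈⟨ +-cong (*-congˡ (∇-suc a m)) (+-congˡ (trans
           (sym (∇-+ (S (a ∘ suc)) a (suc m))) (∇-cong ESc (suc m)))) ⟩
    n * ∇ a m + (s″ + ∇ (S a ∘ suc) (suc m))
      ≈⟨ +-congˡ (∇-suc (S a) (suc m)) ⟩
    n * ∇ a m + ∇ (S a) (suc m)
      ≈⟨ ∇-S a m ⟩
    0# ∎
    where
    n  = fromℕ (suc m)
    d  = ∇ a (suc m)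
    d′ = ∇ (a ∘ suc) m
    s″ = ∇ (S a) (suc (suc m))

    ESc : ∀ i → S (a ∘ suc) i + a i ≈ S a (suc i)
    ESc zero    = solve 1 (λ a → con 0 :+ a := (con 1 :+ con 0) :* a) refl (a 0)
    ESc (suc i) = solve 2 (λ n a → n :* a :+ a := (con 1 :+ n) :* a) refl (fromℕ (suc i)) (a (suc i))

  -- By `∇-suc`, ∇t(m+1) = w ∇t(m) - ∇a(m). Hence -∇t starts at 0 and obeys the recurrence with
  -- ratio `w` and source `∇ a`, whose solution at m+1 is `T w (∇ a) m`. The vanishing sum expresses
  -- this equality without a subtraction.
  ∇-recurrence : ∀ {z w} → z + w ≈ 1# → ∀ (t a : ℕ → ℂ) → t 0 ≈ 0# →
                 (∀ i → t (suc i) ≈ z * t i + a i) →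
                 ∀ m → T w (∇ a) m + ∇ t (suc m) ≈ 0#
  ∇-recurrence {z} {w} z+w≈1 t a t₀≈0 t-suc = go
    where
    ∇t-suc : ∀ m → ∇ t (suc m) + (z * ∇ t m + ∇ a m) ≈ ∇ t m
    ∇t-suc m = begin
      ∇ t (suc m) + (z * ∇ t m + ∇ a m)             ≈⟨ +-congˡ (+-congʳ (∇-*ˡ z t m)) ⟨
      ∇ t (suc m) + (∇ (λ i → z * t i) m + ∇ a m)   ≈⟨ +-congˡ (∇-+ (λ i → z * t i) a m) ⟨
      ∇ t (suc m) + ∇ (λ i → z * t i + a i) m       ≈⟨ +-congˡ (∇-cong t-suc m) ⟨
      ∇ t (suc m) + ∇ (t ∘ suc) m                   ≈⟨ ∇-suc t m ⟩
      ∇ t m                                         ∎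

    w*∇t : ∀ m → w * ∇ t m ≈ ∇ t (suc m) + ∇ a m
    w*∇t m = +-cancelʳ (z * ∇ t m) _ _ (begin
      w * ∇ t m + z * ∇ t m                ≈⟨ solve 3 (λ w z u → w :* u :+ z :* u := (z :+ w) :* u)
                                                refl w z (∇ t m) ⟩
      (z + w) * ∇ t m                      ≈⟨ *-congʳ z+w≈1 ⟩
      1# * ∇ t m                           ≈⟨ *-identityˡ _ ⟩
      ∇ t m                                ≈⟨ ∇t-suc m ⟨
      ∇ t (suc m) + (z * ∇ t m + ∇ a m)    ≈⟨ solve 3 (λ u v a → u :+ (v :+ a) := u :+ a :+ v)
                                                refl (∇ t (suc m)) (z * ∇ t m) (∇ a m) ⟩
      ∇ t (suc m) + ∇ a m + z * ∇ t m      ∎)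

    go : ∀ m → T w (∇ a) m + ∇ t (suc m) ≈ 0#
    go zero = begin
      T w (∇ a) 0 + ∇ t 1   ≈⟨ +-congʳ (T-zero w (∇ a)) ⟩
      ∇ a 0 + ∇ t 1         ≈⟨ +-comm _ _ ⟩
      ∇ t 1 + ∇ a 0         ≈⟨ w*∇t 0 ⟨
      w * ∇ t 0             ≈⟨ *-congˡ (trans (∇-zero t) t₀≈0) ⟩
      w * 0#                ≈⟨ zeroʳ w ⟩
      0#                    ∎
    go (suc m) = begin
      T w (∇ a) (suc m) + ∇ t (suc (suc m))
        ≈⟨ +-congʳ (T-suc w (∇ a) m) ⟩
      w * T w (∇ a) m + ∇ a (suc m) + ∇ t (suc (suc m))
        ≈⟨ trans (+-assoc _ _ _) (+-congˡ (+-comm _ _)) ⟩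
      w * T w (∇ a) m + (∇ t (suc (suc m)) + ∇ a (suc m))
        ≈⟨ +-congˡ (w*∇t (suc m)) ⟨
      w * T w (∇ a) m + w * ∇ t (suc m)
        ≈⟨ distribˡ w _ _ ⟨
      w * (T w (∇ a) m + ∇ t (suc m))
        ≈⟨ trans (*-congˡ (go m)) (zeroʳ w) ⟩
      0# ∎

  -- t = S (Y z a) solves t(i+1) = z t(i) + a(i), and ∇ turns such a recurrence
  -- into the one for 1 − z.
  ∇-Y : ∀ {z w} → z + w ≈ 1# → ∀ a m → ∇ (Y z a) m ≈ Y w (∇ a) m
  ∇-Y {z} {w} z+w≈1 a m = *-cancelˡ (fromℕ≉0 m) (begin
    -- Both sides of this step are the negative of `∇ t (suc m)`: one by absorption, the other by
    -- the recurrence.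
    n * ∇ (Y z a) m                 ≈⟨ +-cancelʳ (∇ t (suc m)) _ _ (trans (∇-S (Y z a) m)
                                         (sym (∇-recurrence z+w≈1 t a refl t-suc m))) ⟩
    T w (∇ a) m                     ≈⟨ S-Y w (∇ a) m ⟨
    n * Y w (∇ a) m                 ∎)
    where
    n = fromℕ (suc m)
    t = S (Y z a)

    S-Y : ∀ z a i → S (Y z a) (suc i) ≈ T z a i
    S-Y z a i = begin
      fromℕ (suc i) * (T z a i * recip i)
        ≈⟨ solve 3 (λ n t r → n :* (t :* r) := n :* r :* t) refl (fromℕ (suc i)) (T z a i) (recip i) ⟩
      fromℕ (suc i) * recip i * T z a i
        ≈⟨ *-congʳ (inverseʳ _ (fromℕ≉0 i)) ⟩
      1# * T z a i
        ≈⟨ *-identityˡ _ ⟩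
      T z a i ∎

    t-suc : ∀ i → t (suc i) ≈ z * t i + a i
    t-suc zero    = trans (S-Y z a 0) (trans (T-zero z a)
      (solve 2 (λ z a → a := z :* con 0 :+ a) refl z (a 0)))
    t-suc (suc i) = trans (S-Y z a (suc i)) (trans (T-suc z a i)
      (+-congʳ (*-congˡ (sym (S-Y z a i)))))

  -- The sequence of the one-letter word y_s, extended to s = 0, where it vanishes.
  geometric : ℂ → ℕ → ℂ
  geometric s m = s ^ suc m * recip m

  -- The last letter contributes the exponent m+1 instead of m. Its sequence is therefore `Y s`
  -- applied to s, 0, 0, ..., which brings one-letter words within reach of `∇-Y`.
  head-only : ℂ → ℕ → ℂ
  head-only s zero    = s
  head-only s (suc _) = 0#

  T-head-only : ∀ z s m → T z (head-only s) m ≈ z ^ m * s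
  T-head-only z s zero    = +-identityʳ _
  T-head-only z s (suc m) = begin
    T z (head-only s) (suc m)     ≈⟨ T-suc z (head-only s) m ⟩
    z * T z (head-only s) m + 0#  ≈⟨ +-identityʳ _ ⟩
    z * T z (head-only s) m       ≈⟨ *-congˡ (T-head-only z s m) ⟩
    z * (z ^ m * s)               ≈⟨ *-assoc z _ s ⟨
    z ^ suc m * s                 ∎

  geometric≈Y : ∀ s m → geometric s m ≈ Y s (head-only s) m
  geometric≈Y s m = *-congʳ (trans (*-comm s (s ^ m)) (sym (T-head-only s s m)))

  -- The shift of `head-only s` is the zero sequence, so `∇-suc` makes the transform constant.
  ∇-head-only : ∀ s m → ∇ (head-only s) m ≈ s
  ∇-head-only s zero    = ∇-zero (head-only s)
  ∇-head-only s (suc m) = begin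
    ∇ (head-only s) (suc m)                  ≈⟨ +-identityʳ _ ⟨
    -- The zero sequence is passed through the form `0# * 0#`, from which `∇-*ˡ` extracts a factor
    -- zero.
    ∇ (head-only s) (suc m) + 0#             ≈⟨ +-congˡ (trans (∇-*ˡ 0# (λ _ → 0#) m) (zeroˡ _)) ⟨
    ∇ (head-only s) (suc m) + ∇ (λ _ → 0# * 0#) m ≈⟨ +-congˡ (∇-cong (λ _ → zeroˡ 0#) m) ⟩
    ∇ (head-only s) (suc m) + ∇ (λ _ → 0#) m ≈⟨ ∇-suc (head-only s) m ⟩
    ∇ (head-only s) m                        ≈⟨ ∇-head-only s m ⟩
    s                                        ∎

  1^ : ∀ n → 1# ^ n ≈ 1#
  1^ zero    = refl
  1^ (suc n) = trans (*-identityˡ _) (1^ n)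

  -- This is the finite geometric series (1 - w)(1 + w + ⋯ + w^m) = 1 - w^(m+1), with s in place of
  -- 1 - w.
  T-const : ∀ {s w} → s + w ≈ 1# → ∀ m → T w (λ _ → s) m + w ^ suc m ≈ 1#
  T-const {s} {w} s+w≈1 zero    = trans (+-cong (T-zero w (λ _ → s)) (*-identityʳ w)) s+w≈1
  T-const {s} {w} s+w≈1 (suc m) = begin
    T w (λ _ → s) (suc m) + w * w ^ suc m
      ≈⟨ +-congʳ (T-suc w (λ _ → s) m) ⟩
    w * T w (λ _ → s) m + s + w * w ^ suc m
      ≈⟨ solve 4 (λ w t s p → w :* t :+ s :+ w :* p := s :+ w :* (t :+ p)) refl w _ s _ ⟩
    s + w * (T w (λ _ → s) m + w ^ suc m)
      ≈⟨ +-congˡ (trans (*-congˡ (T-const s+w≈1 m)) (*-identityʳ w)) ⟩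
    s + w
      ≈⟨ s+w≈1 ⟩
    1# ∎

  ∇-geometric : ∀ {s w} → s + w ≈ 1# → ∀ m →
                ∇ (geometric s) m + geometric w m ≈ geometric 1# m
  ∇-geometric {s} {w} s+w≈1 m = begin
    ∇ (geometric s) m + geometric w m
      ≈⟨ +-congʳ (∇-cong (geometric≈Y s) m) ⟩
    ∇ (Y s (head-only s)) m + geometric w m
      ≈⟨ +-congʳ (∇-Y s+w≈1 (head-only s) m) ⟩
    Y w (∇ (head-only s)) m + geometric w m
      ≈⟨ +-congʳ (Y-cong refl (∇-head-only s) m) ⟩
    Y w (λ _ → s) m + geometric w m
      ≈⟨ distribʳ (recip m) _ _ ⟨
    (T w (λ _ → s) m + w ^ suc m) * recip m
      ≈⟨ *-congʳ (trans (T-const s+w≈1 m) (sym (1^ (suc m)))) ⟩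
    geometric 1# m ∎

-- Rational coefficients in ℂ and the evaluation of formal combinations.

module Evaluation {c ℓ} (ℝ : RealNumbers c ℓ) where

  open Words ℝ
  open Sums ℝ
  open Transform ℝ
  open ≈-Reasoning setoid
  open RingSolver commutativeSemiring
  open RingProperties ring

  fromℤ-neg : ∀ n → fromℤ (ℤ.- (ℤ.+ n)) ≈ - fromℕ n
  fromℤ-neg zero    = sym -0#≈0#
  fromℤ-neg (suc n) = refl

  fromℤ-* : ∀ i j → fromℤ (i ℤ.* j) ≈ fromℤ i * fromℤ j
  fromℤ-* (ℤ.+ m) (ℤ.+ n) = trans
    (reflexive (≡.cong fromℤ (≡.sym (ℤ.pos-* m n)))) (Mult.×1-homo-* semiring m n)
  fromℤ-* (ℤ.+ m) -[1+ n ] = begin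
    fromℤ (ℤ.+ m ℤ.* -[1+ n ])       ≡⟨ ≡.cong fromℤ (ℤ.neg-distribʳ-* (ℤ.+ m) (ℤ.+ suc n)) ⟨
    fromℤ (ℤ.- (ℤ.+ m ℤ.* ℤ.+ suc n)) ≡⟨ ≡.cong (fromℤ ∘ ℤ.-_) (ℤ.pos-* m (suc n)) ⟨
    fromℤ (ℤ.- (ℤ.+ (m ℕ.* suc n)))   ≈⟨ fromℤ-neg (m ℕ.* suc n) ⟩
    - fromℕ (m ℕ.* suc n)           ≈⟨ -‿cong (Mult.×1-homo-* semiring m (suc n)) ⟩
    - (fromℕ m * fromℕ (suc n))     ≈⟨ -‿distribʳ-* _ _ ⟩
    fromℕ m * - fromℕ (suc n)       ∎
  fromℤ-* -[1+ m ] (ℤ.+ n) = begin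
    fromℤ (-[1+ m ] ℤ.* ℤ.+ n)       ≡⟨ ≡.cong fromℤ (ℤ.*-comm -[1+ m ] (ℤ.+ n)) ⟩
    fromℤ (ℤ.+ n ℤ.* -[1+ m ])       ≈⟨ fromℤ-* (ℤ.+ n) -[1+ m ] ⟩
    fromℕ n * - fromℕ (suc m)       ≈⟨ *-comm _ _ ⟩
    - fromℕ (suc m) * fromℕ n       ∎
  fromℤ-* -[1+ m ] -[1+ n ] = begin
    fromℕ (suc m ℕ.* suc n)               ≈⟨ Mult.×1-homo-* semiring (suc m) (suc n) ⟩
    fromℕ (suc m) * fromℕ (suc n)         ≈⟨ -‿involutive _ ⟨
    - - (fromℕ (suc m) * fromℕ (suc n))   ≈⟨ -‿cong (-‿distribʳ-* _ _) ⟩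
    - (fromℕ (suc m) * - fromℕ (suc n))   ≈⟨ -‿distribˡ-* _ _ ⟩
    - fromℕ (suc m) * - fromℕ (suc n)     ∎

  cross-multiply : ∀ {z w u v} → ¬ w ≈ 0# → ¬ v ≈ 0# → z * v ≈ u * w → z * w ⁻¹ ≈ u * v ⁻¹
  cross-multiply {z} {w} {u} {v} w≉0 v≉0 zv≈uw = begin
    z * w ⁻¹                   ≈⟨ *-identityʳ _ ⟨
    z * w ⁻¹ * 1#              ≈⟨ *-congˡ (inverseʳ v v≉0) ⟨
    z * w ⁻¹ * (v * v ⁻¹)      ≈⟨ solve 4 (λ z i v j → z :* i :* (v :* j) := z :* v :* (i :* j))
                                    refl z (w ⁻¹) v (v ⁻¹) ⟩
    z * v * (w ⁻¹ * v ⁻¹)      ≈⟨ *-congʳ zv≈uw ⟩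
    u * w * (w ⁻¹ * v ⁻¹)      ≈⟨ solve 4 (λ u w i j → u :* w :* (i :* j) := u :* j :* (w :* i))
                                    refl u w (w ⁻¹) (v ⁻¹) ⟩
    u * v ⁻¹ * (w * w ⁻¹)      ≈⟨ *-congˡ (inverseʳ w w≉0) ⟩
    u * v ⁻¹ * 1#              ≈⟨ *-identityʳ _ ⟩
    u * v ⁻¹                   ∎

  -- Products in ℚ are reduced to lowest terms, so numerators and denominators are multiplicative
  -- only after cross-multiplication. That equation is read off from the unnormalised rationals; the
  -- record patterns let `toℚᵘ` compute on the factors.
  ↥↧-* : ∀ p q → ℚ.↥ (p ℚ.* q) ℤ.* (ℚ.↧ p ℤ.* ℚ.↧ q) ≡
                 (ℚ.↥ p ℤ.* ℚ.↥ q) ℤ.* ℚ.↧ (p ℚ.* q)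
  ↥↧-* p@record{} q@record{} with ℚ.toℚᵘ-homo-* p q
  ... | ℚᵘ.*≡* eq = ≡.trans (≡.cong (ℤ._* (ℚ.↧ p ℤ.* ℚ.↧ q)) (≡.sym (ℚ.↥ᵘ-toℚᵘ (p ℚ.* q))))
    (≡.trans eq (≡.cong ((ℚ.↥ p ℤ.* ℚ.↥ q) ℤ.*_) (ℚ.↧ᵘ-toℚᵘ (p ℚ.* q))))

  fromℤ-↧≉0 : ∀ p → ¬ fromℤ (ℚ.↧ p) ≈ 0#
  fromℤ-↧≉0 p = fromℕ≉0 (ℚ.denominator-1 p)

  fromℚ-* : ∀ p q → fromℚ (p ℚ.* q) ≈ fromℚ p * fromℚ q
  fromℚ-* p q = begin
    fromℤ (ℚ.↥ (p ℚ.* q)) * fromℤ (ℚ.↧ (p ℚ.* q)) ⁻¹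
      ≈⟨ cross-multiply (fromℤ-↧≉0 (p ℚ.* q)) (*-≉0 (fromℤ-↧≉0 p) (fromℤ-↧≉0 q)) (begin
           fromℤ (ℚ.↥ (p ℚ.* q)) * (b * d)
             ≈⟨ *-congˡ (fromℤ-* (ℚ.↧ p) (ℚ.↧ q)) ⟨
           fromℤ (ℚ.↥ (p ℚ.* q)) * fromℤ (ℚ.↧ p ℤ.* ℚ.↧ q)
             ≈⟨ fromℤ-* (ℚ.↥ (p ℚ.* q)) (ℚ.↧ p ℤ.* ℚ.↧ q) ⟨
           fromℤ (ℚ.↥ (p ℚ.* q) ℤ.* (ℚ.↧ p ℤ.* ℚ.↧ q))
             ≡⟨ ≡.cong fromℤ (↥↧-* p q) ⟩
           fromℤ ((ℚ.↥ p ℤ.* ℚ.↥ q) ℤ.* ℚ.↧ (p ℚ.* q))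
             ≈⟨ fromℤ-* (ℚ.↥ p ℤ.* ℚ.↥ q) (ℚ.↧ (p ℚ.* q)) ⟩
           fromℤ (ℚ.↥ p ℤ.* ℚ.↥ q) * fromℤ (ℚ.↧ (p ℚ.* q))
             ≈⟨ *-congʳ (fromℤ-* (ℚ.↥ p) (ℚ.↥ q)) ⟩
           a * c′ * fromℤ (ℚ.↧ (p ℚ.* q)) ∎) ⟩
    a * c′ * (b * d) ⁻¹
      ≈⟨ *-congˡ (⁻¹-distrib-* (fromℤ-↧≉0 p) (fromℤ-↧≉0 q)) ⟩
    a * c′ * (b ⁻¹ * d ⁻¹)
      ≈⟨ solve 4 (λ a c i j → a :* c :* (i :* j) := a :* i :* (c :* j)) refl a c′ (b ⁻¹) (d ⁻¹) ⟩
    fromℚ p * fromℚ q ∎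
    where
    a  = fromℤ (ℚ.↥ p)
    b  = fromℤ (ℚ.↧ p)
    c′ = fromℤ (ℚ.↥ q)
    d  = fromℤ (ℚ.↧ q)

  fromℚ-0 : fromℚ 0ℚ ≈ 0#
  fromℚ-0 = zeroˡ _

  fromℚ-1 : fromℚ 1ℚ ≈ 1#
  fromℚ-1 = inverseʳ _ (fromℕ≉0 0)

  fromℚ--1 : fromℚ (ℚ.- 1ℚ) ≈ - 1#
  fromℚ--1 = trans (sym (-‿distribˡ-* _ _)) (-‿cong fromℚ-1)

  module _ {b} {B : Set b} where

    -- The linear extension of F, of which sˢʰ is an instance.
    eval : (B → ℂ) → Lin B → ℂ
    eval F v = ∑ v λ (q , b) → fromℚ q * F b

    eval-cong : ∀ {F G} → (∀ b → F b ≈ G b) → ∀ v → eval F v ≈ eval G v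
    eval-cong F≈G v = ∑-cong v λ (_ , b) → *-congˡ (F≈G b)

    eval-⟨⟩ : ∀ F b → eval F ⟨ b ⟩ ≈ F b
    eval-⟨⟩ F b = trans (+-identityʳ _) (trans (*-congʳ fromℚ-1) (*-identityˡ _))

    eval-⊞ : ∀ F u v → eval F (u ⊞ v) ≈ eval F u + eval F v
    eval-⊞ F u v = ∑-++ u v _

    eval-• : ∀ F q v → eval F (q • v) ≈ fromℚ q * eval F v
    eval-• F q v = begin
      eval F (q • v)                                    ≡⟨ ∑-map _ v _ ⟩
      ∑ v (λ (r , b) → fromℚ (q ℚ.* r) * F b)           ≈⟨ ∑-cong v (λ (r , b) →
                                                             trans (*-congʳ (fromℚ-* q r)) (*-assoc _ _ _)) ⟩
      ∑ v (λ (r , b) → fromℚ q * (fromℚ r * F b))       ≈⟨ ∑-distribˡ v (fromℚ q) _ ⟩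
      fromℚ q * eval F v                                ∎

    eval-0• : ∀ F v → eval F (0ℚ • v) ≈ 0#
    eval-0• F v = trans (eval-• F 0ℚ v) (trans (*-congʳ fromℚ-0) (zeroˡ _))

    eval-1• : ∀ F v → eval F (1ℚ • v) ≈ eval F v
    eval-1• F v = trans (eval-• F 1ℚ v) (trans (*-congʳ fromℚ-1) (*-identityˡ _))

    eval-⊟ : ∀ F u v → eval F (u ⊟ v) ≈ eval F u - eval F v
    eval-⊟ F u v = trans (eval-⊞ F u _) (+-congˡ
      (trans (eval-• F (ℚ.- 1ℚ) v) (trans (*-congʳ fromℚ--1) (-1*x≈-x _))))

    T-eval : ∀ z (F : B → ℕ → ℂ) v m →
             T z (λ j → eval (λ b → F b j) v) m ≈ eval (λ b → T z (F b) m) v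
    T-eval z F v m = trans (T-∑ v z (λ (q , b) j → fromℚ q * F b j) m)
      (∑-cong v λ (q , b) → T-*ˡ z (fromℚ q) (F b) m)

    Y-eval : ∀ z (F : B → ℕ → ℂ) v m →
             Y z (λ j → eval (λ b → F b j) v) m ≈ eval (λ b → Y z (F b) m) v
    Y-eval z F v m = begin
      T z (λ j → eval (λ b → F b j) v) m * recip m        ≈⟨ *-congʳ (T-eval z F v m) ⟩
      eval (λ b → T z (F b) m) v * recip m                ≈⟨ ∑-distribʳ v (recip m) _ ⟨
      ∑ v (λ (q , b) → fromℚ q * T z (F b) m * recip m)   ≈⟨ ∑-cong v (λ _ → *-assoc _ _ _) ⟩
      eval (λ b → Y z (F b) m) v                          ∎

  module _ {a b} {A : Set a} {B : Set b} where

    eval-linear : ∀ F (h : A → Lin B) v → eval F (linear h v) ≈ eval (λ a → eval F (h a)) v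
    eval-linear F h v = trans
      (∑-concatMap (λ (q , a) → q • h a) v _)
      (∑-cong v λ (q , a) → eval-• F q (h a))

    eval-linear-⟨⟩ : ∀ F (h : A → Lin B) a → eval F (linear h ⟨ a ⟩) ≈ eval F (h a)
    eval-linear-⟨⟩ F h a = trans (eval-linear F h ⟨ a ⟩) (eval-⟨⟩ (λ a → eval F (h a)) a)

  eval-bilinear : ∀ {a b d} {A : Set a} {B : Set b} {D : Set d}
                  F (h : A → B → D) u v →
                  eval F (bilinear h u v) ≈ eval (λ a → eval (λ b → F (h a b)) v) u
  eval-bilinear F h u v = trans
    (eval-linear F (λ a → linear (λ b → ⟨ h a b ⟩) v) u)
    (eval-cong (λ a → trans
      (eval-linear F (λ b → ⟨ h a b ⟩) v)
      (eval-cong (λ b → eval-⟨⟩ F (h a b)) v)) u)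

-- Word sequences as iterates of `Y`.

module WordSequences {c ℓ} (ℝ : RealNumbers c ℓ) where

  open Words ℝ
  open Sums ℝ
  open Transform ℝ
  open ≈-Reasoning setoid
  open RingSolver commutativeSemiring

  -- `chains` inspects the length before it puts `m` in front. Naming the remainder exposes the
  -- first entry for every length at once.
  tails : (n m : ℕ) → List (Vec ℕ n)
  tails zero    m = [ [] ]
  tails (suc n) m = concatMap (chains n) (upTo (suc m))

  chains≡ : ∀ n m → chains n m ≡ map (m ∷_) (tails n m)
  chains≡ zero    m = ≡.refl
  chains≡ (suc n) m = ≡.refl

  ∑-chains : ∀ n m (f : Vec ℕ (suc n) → ℂ) →
             ∑ (chains n m) f ≡ ∑ (tails n m) (λ ms → f (m ∷ ms))
  ∑-chains n m f = ≡.trans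
    (≡.cong (λ l → ∑ l f) (chains≡ n m))
    (∑-map (m ∷_) (tails n m) f)

  denominator≉0 : ∀ {n} (bs : Vec Block n) ms → ¬ denominator bs ms ≈ 0#
  denominator≉0 []       []       = 1≉0
  denominator≉0 (b ∷ bs) (m ∷ ms) =
    *-≉0 (^-≉0 (fromℕ≉0 m) (Block.k b)) (denominator≉0 bs ms)

  term : ∀ {n} → Vec Block (suc n) → Vec ℕ (suc n) → ℂ
  term bs ms = numerator bs ms * denominator bs ms ⁻¹

  blockSequence : Blocks → ℕ → ℂ
  blockSequence (n , bs) m = ∑ (chains n m) (term bs)

  term-prependX : ∀ {n} j s (bs : Vec Block n) m ms →
                  term ((suc j , s) ∷ bs) (m ∷ ms) ≈ term ((j , s) ∷ bs) (m ∷ ms) * recip m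
  term-prependX j s bs m ms = begin
    numerator ((suc j , s) ∷ bs) (m ∷ ms) * (f * f ^ suc j * d) ⁻¹
      ≈⟨ *-cong (reflexive (numerator-k bs ms)) (begin
           (f * f ^ suc j * d) ⁻¹      ≈⟨ ⁻¹-cong (*-≉0 (^-≉0 f≉0 (suc (suc j))) d≉0) (*-assoc _ _ _) ⟩
           (f * (f ^ suc j * d)) ⁻¹    ≈⟨ ⁻¹-distrib-* f≉0 (*-≉0 (^-≉0 f≉0 (suc j)) d≉0) ⟩
           f ⁻¹ * (f ^ suc j * d) ⁻¹   ≈⟨ *-comm _ _ ⟩
           (f ^ suc j * d) ⁻¹ * f ⁻¹   ∎) ⟩
    numerator ((j , s) ∷ bs) (m ∷ ms) * ((f ^ suc j * d) ⁻¹ * f ⁻¹)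
      ≈⟨ *-assoc _ _ _ ⟨
    term ((j , s) ∷ bs) (m ∷ ms) * recip m ∎
    where
    f   = fromℕ (suc m)
    f≉0 = fromℕ≉0 m
    d   = denominator bs ms
    d≉0 = denominator≉0 bs ms

    -- Exponents do not enter the numerator, but `numerator` computes only once the tail is split.
    numerator-k : ∀ {n} (bs : Vec Block n) ms →
                  numerator ((suc j , s) ∷ bs) (m ∷ ms) ≡ numerator ((j , s) ∷ bs) (m ∷ ms)
    numerator-k []      []      = ≡.refl
    numerator-k (_ ∷ _) (_ ∷ _) = ≡.refl

  term-prependY : ∀ {n} (s : ℂˣ) (bs : Vec Block (suc n)) m j ms →
                  term ((0 , s) ∷ bs) (m ∷ j ∷ ms) ≈
                  proj₁ s ^ (m ∸ j) * term bs (j ∷ ms) * recip m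
  term-prependY s bs@(_ ∷ _) m j ms = begin
    p * n * (f * 1# * d) ⁻¹      ≈⟨ *-congˡ (⁻¹-cong (*-≉0 (^-≉0 (fromℕ≉0 m) 1) d≉0)
                                      (*-congʳ (*-identityʳ f))) ⟩
    p * n * (f * d) ⁻¹           ≈⟨ *-congˡ (⁻¹-distrib-* (fromℕ≉0 m) d≉0) ⟩
    p * n * (f ⁻¹ * d ⁻¹)        ≈⟨ solve 4 (λ p n i j → p :* n :* (i :* j) := p :* (n :* j) :* i)
                                      refl p n (f ⁻¹) (d ⁻¹) ⟩
    p * (n * d ⁻¹) * f ⁻¹        ∎
    where
    f   = fromℕ (suc m)
    p   = proj₁ s ^ (m ∸ j)
    n   = numerator bs (j ∷ ms)
    d   = denominator bs (j ∷ ms)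
    d≉0 = denominator≉0 bs (j ∷ ms)

  blockSequence-prependX : ∀ bs m → blockSequence (prependX bs) m ≈ blockSequence bs m * recip m
  blockSequence-prependX (n , (j , s) ∷ bs) m = begin
    ∑ (chains n m) (term ((suc j , s) ∷ bs))
      ≡⟨ ∑-chains n m _ ⟩
    ∑ (tails n m) (λ ms → term ((suc j , s) ∷ bs) (m ∷ ms))
      ≈⟨ ∑-cong (tails n m) (term-prependX j s bs m) ⟩
    ∑ (tails n m) (λ ms → term ((j , s) ∷ bs) (m ∷ ms) * recip m)
      ≈⟨ ∑-distribʳ (tails n m) (recip m) _ ⟩
    ∑ (tails n m) (λ ms → term ((j , s) ∷ bs) (m ∷ ms)) * recip m
      ≡⟨ ≡.cong (_* recip m) (∑-chains n m (term ((j , s) ∷ bs))) ⟨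
    ∑ (chains n m) (term ((j , s) ∷ bs)) * recip m ∎

  blockSequence-prependY : ∀ s bs m →
    blockSequence (prependY s bs) m ≈ Y (proj₁ s) (blockSequence bs) m
  blockSequence-prependY s (n , bs) m = begin
    ∑ (chains (suc n) m) (term ((0 , s) ∷ bs))
      ≡⟨ ∑-chains (suc n) m (term ((0 , s) ∷ bs)) ⟩
    ∑ (concatMap (chains n) (upTo (suc m))) (λ ms → term ((0 , s) ∷ bs) (m ∷ ms))
      ≈⟨ ∑-concatMap (chains n) (upTo (suc m)) _ ⟩
    ∑ (upTo (suc m)) (λ j → ∑ (chains n j) (λ ms → term ((0 , s) ∷ bs) (m ∷ ms)))
      ≈⟨ ∑-cong (upTo (suc m)) inner ⟩
    ∑ (upTo (suc m)) (λ j → proj₁ s ^ (m ∸ j) * blockSequence (n , bs) j * recip m)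
      ≈⟨ ∑-distribʳ (upTo (suc m)) (recip m) _ ⟩
    Y (proj₁ s) (blockSequence (n , bs)) m ∎
    where
    inner : ∀ j → ∑ (chains n j) (λ ms → term ((0 , s) ∷ bs) (m ∷ ms)) ≈
                  proj₁ s ^ (m ∸ j) * blockSequence (n , bs) j * recip m
    inner j = begin
      ∑ (chains n j) (λ ms → term ((0 , s) ∷ bs) (m ∷ ms))
        ≡⟨ ∑-chains n j (λ ms → term ((0 , s) ∷ bs) (m ∷ ms)) ⟩
      ∑ (tails n j) (λ ms → term ((0 , s) ∷ bs) (m ∷ j ∷ ms))
        ≈⟨ ∑-cong (tails n j) (term-prependY s bs m j) ⟩
      ∑ (tails n j) (λ ms → p * term bs (j ∷ ms) * recip m)
        ≈⟨ ∑-distribʳ (tails n j) (recip m) (λ ms → p * term bs (j ∷ ms)) ⟩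
      ∑ (tails n j) (λ ms → p * term bs (j ∷ ms)) * recip m
        ≈⟨ *-congʳ (∑-distribˡ (tails n j) p (λ ms → term bs (j ∷ ms))) ⟩
      p * ∑ (tails n j) (λ ms → term bs (j ∷ ms)) * recip m
        ≡⟨ ≡.cong (λ t → p * t * recip m) (∑-chains n j (term bs)) ⟨
      p * blockSequence (n , bs) j * recip m ∎
      where p = proj₁ s ^ (m ∸ j)

  letterValue : Letter → ℂ
  letterValue x     = 0#
  letterValue (y s) = proj₁ s

  sˢʰ-word-[] : ∀ s m → sˢʰ-word ([] , s) m ≈ geometric (proj₁ s) m
  sˢʰ-word-[] s m = trans (+-identityʳ _) (*-congˡ (⁻¹-cong
    (*-≉0 (^-≉0 (fromℕ≉0 m) 1) 1≉0)
    (trans (*-identityʳ _) (*-identityʳ _))))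

  sˢʰ-word-∷ : ∀ l u s m →
    sˢʰ-word (l ∷ u , s) m ≈ Y (letterValue l) (sˢʰ-word (u , s)) m
  sˢʰ-word-∷ x     u s m = trans
    (blockSequence-prependX (blocks (u , s)) m)
    (sym (Y-0# (sˢʰ-word (u , s)) m))
  sˢʰ-word-∷ (y t) u s m = blockSequence-prependY t (blocks (u , s)) m

-- Substitutions pulled back to word sequences, and the duality.

module Duality {c ℓ} (ℝ : RealNumbers c ℓ) where

  open Words ℝ
  open Sums ℝ
  open Transform ℝ
  open Evaluation ℝ
  open WordSequences ℝ
  open ≈-Reasoning setoid
  open RingProperties ring

  Realises : (Letter → ℂ) → (Word → ℕ → ℂ) → Set (c ⊔ ℓ)
  Realises ρ H = ∀ l w m → H (l ∷ w) m ≈ Y (ρ l) (H w) m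

  -- `K` abstracts from what follows the letter: in use, `K b` is the sum of a family over a whole
  -- combination of words, each prefixed by `b`.
  ActsAs : (Letter → ℂ) → 𝒜 → ℂ → Set (c ⊔ ℓ)
  ActsAs ρ A z = ∀ (K : Word → ℕ → ℂ) → (∀ l m → K [ l ] m ≈ Y (ρ l) (K []) m) →
                 ∀ m → eval (λ w → K w m) A ≈ Y z (K []) m

  -- Precomposition with the substitution, hence contravariant: for `α` after `ι`, the pullback
  -- along `α` is taken first and the one along `ι` second.
  pullback : (Letter → 𝒜) → (Word → ℕ → ℂ) → Word → ℕ → ℂ
  pullback g H w m = eval (λ a → H a m) (algebraHom g ⟨ w ⟩)

  module _ (g : Letter → 𝒜) where

    private
      ĝ : Word → 𝒜
      ĝ = foldr (λ l u → g l · u) ⟨ [] ⟩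

    eval-algebraHom : ∀ F v →
      eval F (algebraHom g v) ≈ eval (λ w → eval F (algebraHom g ⟨ w ⟩)) v
    eval-algebraHom F v = trans
      (eval-linear F ĝ v)
      (eval-cong (λ w → sym (eval-linear-⟨⟩ F ĝ w)) v)

    -- The image of `l ∷ w` is `g l` times the image of `w`. Summing `H` over the second factor
    -- leaves the family `K` in the first; a letter still acts on `K` by `Y`, because `Y` commutes
    -- with linear combinations.
    pullback-realises : ∀ {ρ σ} → ActsAs ρ (g x) (σ x) →
      (∀ s → ActsAs ρ (g (y s)) (σ (y s))) →
      ∀ {H} → Realises ρ H → Realises σ (pullback g H)
    pullback-realises {ρ} {σ} gx gy {H} H-realises l w m = begin
      pullback g H (l ∷ w) m
        ≈⟨ eval-linear-⟨⟩ (λ a → H a m) ĝ (l ∷ w) ⟩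
      eval (λ a → H a m) (g l · ĝ w)
        ≈⟨ eval-bilinear (λ a → H a m) _++_ (g l) (ĝ w) ⟩
      eval (λ b → K b m) (g l)
        ≈⟨ gl l K K-letter m ⟩
      Y (σ l) (K []) m
        ≈⟨ Y-cong refl (λ j → eval-linear-⟨⟩ (λ a → H a j) ĝ w) m ⟨
      Y (σ l) (pullback g H w) m ∎
      where
      K : Word → ℕ → ℂ
      K b m = eval (λ a → H (b ++ a) m) (ĝ w)

      K-letter : ∀ l m → K [ l ] m ≈ Y (ρ l) (K []) m
      K-letter l m = trans
        (eval-cong (λ a → H-realises l a m) (ĝ w))
        (sym (Y-eval (ρ l) H (ĝ w) m))

      gl : ∀ l → ActsAs ρ (g l) (σ l)
      gl x     = gx
      gl (y s) = gy s

  δ≡0 : ∀ {z} → z ≈ 1# → δ z ≡ 0ℚ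
  δ≡0 {z} z≈1 with z ≟ 0# | z ≟ 1#
  ... | yes _ | _      = ≡.refl
  ... | no  _ | yes _  = ≡.refl
  ... | no  _ | no z≉1 = contradiction z≈1 z≉1

  δ≡1 : ∀ {z} → ¬ z ≈ 0# → ¬ z ≈ 1# → δ z ≡ 1ℚ
  δ≡1 {z} z≉0 z≉1 with z ≟ 0# | z ≟ 1#
  ... | yes z≈0 | _       = contradiction z≈0 z≉0
  ... | no  _   | yes z≈1 = contradiction z≈1 z≉1
  ... | no  _   | no  _   = ≡.refl

  -- `y₁₋` makes its own decision on s = 1 and stores the resulting proof in the letter, so the
  -- value of `F` is required for every such proof.
  eval-y₁₋ : ∀ F s {v} → ¬ proj₁ s ≈ 1# →
             (∀ s≉1 → F (1- proj₁ s [ s≉1 ]) ≈ v) → eval F (y₁₋ s) ≈ v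
  eval-y₁₋ F (z , _) z≉1 F≈v with z ≟ 1#
  ... | yes z≈1  = contradiction z≈1 z≉1
  ... | no  z≉1′ = trans (eval-⟨⟩ F (1- z [ z≉1′ ])) (F≈v z≉1′)

  eval-δ-≈1 : ∀ {b} {B : Set b} (F : B → ℂ) {z} → z ≈ 1# → ∀ u v →
              eval F (δ z • u ⊞ (1ℚ ℚ.- δ z) • v) ≈ eval F v
  eval-δ-≈1 F z≈1 u v rewrite δ≡0 z≈1 = begin
    eval F (0ℚ • u ⊞ 1ℚ • v)           ≈⟨ eval-⊞ F (0ℚ • u) (1ℚ • v) ⟩
    eval F (0ℚ • u) + eval F (1ℚ • v)  ≈⟨ +-cong (eval-0• F u) (eval-1• F v) ⟩
    0# + eval F v                      ≈⟨ +-identityˡ _ ⟩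
    eval F v                           ∎

  eval-δ-≉1 : ∀ {b} {B : Set b} (F : B → ℂ) {z} → ¬ z ≈ 0# → ¬ z ≈ 1# → ∀ u v →
              eval F (δ z • u ⊞ (1ℚ ℚ.- δ z) • v) ≈ eval F u
  eval-δ-≉1 F z≉0 z≉1 u v rewrite δ≡1 z≉0 z≉1 = begin
    eval F (1ℚ • u ⊞ 0ℚ • v)           ≈⟨ eval-⊞ F (1ℚ • u) (0ℚ • v) ⟩
    eval F (1ℚ • u) + eval F (0ℚ • v)  ≈⟨ +-cong (eval-1• F u) (eval-0• F v) ⟩
    eval F u + 0#                      ≈⟨ +-identityʳ _ ⟩
    eval F u                           ∎

  eval-⊞-comm : ∀ {b} {B : Set b} (F : B → ℂ) u v → eval F (u ⊞ v) ≈ eval F (v ⊞ u)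
  eval-⊞-comm F u v = trans (eval-⊞ F u v) (trans (+-comm _ _) (sym (eval-⊞ F v u)))

  -- α exchanges x and y₁ and fixes the other letters, so y_s goes to the value
  -- 0 of x if s = 1 and keeps its value s otherwise.
  αValue : Letter → ℂ
  αValue x           = 1#
  αValue (y (z , _)) = fromℚ (δ z) * z

  αValue-≈1 : ∀ s → proj₁ s ≈ 1# → αValue (y s) ≈ 0#
  αValue-≈1 s s≈1 rewrite δ≡0 s≈1 = trans (*-congʳ fromℚ-0) (zeroˡ _)

  αValue-≉1 : ∀ s → ¬ proj₁ s ≈ 1# → αValue (y s) ≈ proj₁ s
  αValue-≉1 s s≉1 rewrite δ≡1 (proj₂ s) s≉1 = trans (*-congʳ fromℚ-1) (*-identityˡ _)

  αLetter : Letter → 𝒜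
  αLetter x     = ⟨ [ y 1ˣ ] ⟩
  αLetter (y s) = (1ℚ ℚ.- δ (proj₁ s)) • ⟨ [ x ] ⟩ ⊞ δ (proj₁ s) • ⟨ [ y s ] ⟩

  ιLetter : Letter → 𝒜
  ιLetter x     = ⟨ [ x ] ⟩
  ιLetter (y s) = letters (δ (proj₁ s) • y₁₋ s ⊞ (1ℚ ℚ.- δ (proj₁ s)) • ⟨ 1ˣ ⟩)

  -- The letter maps inside α and ι are anonymous; unification finds the step
  -- function c of the fold, but not the factor g in c l u = g l · u.
  linear-foldr≡ : ∀ c g → (∀ l u → c l u ≡ g l · u) → ∀ v →
                  linear (foldr c ⟨ [] ⟩) v ≡ algebraHom g v
  linear-foldr≡ c g c≡g v = List.concatMap-cong
    (λ (q , w) → ≡.cong (q •_) (foldr≡ w)) v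
    where
    foldr≡ : ∀ w → foldr c ⟨ [] ⟩ w ≡ foldr (λ l u → g l · u) ⟨ [] ⟩ w
    foldr≡ []      = ≡.refl
    foldr≡ (l ∷ w) = ≡.trans (c≡g l _) (≡.cong (g l ·_) (foldr≡ w))

  α≡ : ∀ v → α v ≡ algebraHom αLetter v
  α≡ = linear-foldr≡ _ αLetter λ where
    x     u → ≡.refl
    (y s) u → ≡.refl

  ι≡ : ∀ v → ι v ≡ algebraHom ιLetter v
  ι≡ = linear-foldr≡ _ ιLetter λ where
    x     u → ≡.refl
    (y s) u → ≡.refl

  α-realises : ∀ {H} → Realises letterValue H → Realises αValue (pullback αLetter H)
  α-realises = pullback-realises αLetter αx αy
    where
    αx : ActsAs letterValue (αLetter x) 1#
    αx K K-letter m = trans (eval-⟨⟩ (λ w → K w m) [ y 1ˣ ]) (K-letter (y 1ˣ) m)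

    αy : ∀ s → ActsAs letterValue (αLetter (y s)) (αValue (y s))
    αy s K K-letter m = trans
      -- `αLetter` lists the summand with coefficient 1 - δ first, while `eval-δ-≈1` and `eval-δ-≉1`
      -- expect it last.
      (eval-⊞-comm F ((1ℚ ℚ.- δ (proj₁ s)) • ⟨ [ x ] ⟩) (δ (proj₁ s) • ⟨ [ y s ] ⟩))
      (by-cases (proj₁ s ≟ 1#))
      where
      F = λ w → K w m

      by-cases : Dec (proj₁ s ≈ 1#) →
        eval F (δ (proj₁ s) • ⟨ [ y s ] ⟩ ⊞ (1ℚ ℚ.- δ (proj₁ s)) • ⟨ [ x ] ⟩) ≈
        Y (αValue (y s)) (K []) m
      by-cases (yes s≈1) = begin
        _                         ≈⟨ eval-δ-≈1 F s≈1 ⟨ [ y s ] ⟩ ⟨ [ x ] ⟩ ⟩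
        eval F ⟨ [ x ] ⟩          ≈⟨ eval-⟨⟩ F [ x ] ⟩
        K [ x ] m                 ≈⟨ K-letter x m ⟩
        Y 0# (K []) m             ≈⟨ Y-congʳ (αValue-≈1 s s≈1) (K []) m ⟨
        Y (αValue (y s)) (K []) m ∎
      by-cases (no s≉1) = begin
        _                         ≈⟨ eval-δ-≉1 F (proj₂ s) s≉1 ⟨ [ y s ] ⟩ ⟨ [ x ] ⟩ ⟩
        eval F ⟨ [ y s ] ⟩        ≈⟨ eval-⟨⟩ F [ y s ] ⟩
        K [ y s ] m               ≈⟨ K-letter (y s) m ⟩
        Y (proj₁ s) (K []) m      ≈⟨ Y-congʳ (αValue-≉1 s s≉1) (K []) m ⟨
        Y (αValue (y s)) (K []) m ∎

  z+[1-z]≈1 : ∀ z → z + (1# - z) ≈ 1#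
  z+[1-z]≈1 z = begin
    z + (1# - z)    ≈⟨ +-comm _ _ ⟩
    1# - z + z      ≈⟨ +-assoc _ _ _ ⟩
    1# + (- z + z)  ≈⟨ +-congˡ (-‿inverseˡ z) ⟩
    1# + 0#         ≈⟨ +-identityʳ 1# ⟩
    1#              ∎

  1-z≈0 : ∀ {z} → z ≈ 1# → 1# - z ≈ 0#
  1-z≈0 z≈1 = x≈y⇒x∙y⁻¹≈ε (sym z≈1)

  -- Ensures that `α` fixes the letter y_{1-s} produced by `ι`: it is never y₁, since the index s of
  -- a letter is nonzero.
  1-z≉1 : ∀ {z} → ¬ z ≈ 0# → ¬ 1# - z ≈ 1#
  1-z≉1 {z} z≉0 1-z≈1 = z≉0 (+-cancelʳ 1# z 0# (begin
    z + 1#        ≈⟨ +-congˡ 1-z≈1 ⟨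
    z + (1# - z)  ≈⟨ z+[1-z]≈1 z ⟩
    1#            ≈⟨ +-identityˡ 1# ⟨
    0# + 1#       ∎))

  dualValue : Letter → ℂ
  dualValue l = 1# - letterValue l

  -- The reflection z ↦ 1 - z is split in two: `α` exchanges the values 0 and 1 and fixes the
  -- others, while `ι` fixes 0 and 1 and reflects the others.
  ι-realises : ∀ {H} → Realises αValue H → Realises dualValue (pullback ιLetter H)
  ι-realises = pullback-realises ιLetter ιx ιy
    where
    ιx : ActsAs αValue (ιLetter x) (1# - 0#)
    ιx K K-letter m = begin
      eval (λ w → K w m) ⟨ [ x ] ⟩  ≈⟨ eval-⟨⟩ (λ w → K w m) [ x ] ⟩
      K [ x ] m                     ≈⟨ K-letter x m ⟩
      Y 1# (K []) m                 ≈⟨ Y-congʳ (trans (+-congˡ -0#≈0#) (+-identityʳ 1#)) (K []) m ⟨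
      Y (1# - 0#) (K []) m          ∎

    ιy : ∀ s → ActsAs αValue (ιLetter (y s)) (1# - proj₁ s)
    ιy s K K-letter m = begin
      eval (λ w → K w m) (letters L)
        ≈⟨ eval-linear (λ w → K w m) (λ t → ⟨ [ y t ] ⟩) L ⟩
      eval (λ t → eval (λ w → K w m) ⟨ [ y t ] ⟩) L
        ≈⟨ eval-cong (λ t → trans (eval-⟨⟩ (λ w → K w m) [ y t ]) (K-letter (y t) m)) L ⟩
      eval F L
        ≈⟨ by-cases (proj₁ s ≟ 1#) ⟩
      Y (1# - proj₁ s) (K []) m ∎
      where
      L = δ (proj₁ s) • y₁₋ s ⊞ (1ℚ ℚ.- δ (proj₁ s)) • ⟨ 1ˣ ⟩

      F : ℂˣ → ℂ
      F t = Y (αValue (y t)) (K []) m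

      by-cases : Dec (proj₁ s ≈ 1#) → eval F L ≈ Y (1# - proj₁ s) (K []) m
      by-cases (yes s≈1) = begin
        eval F L                   ≈⟨ eval-δ-≈1 F s≈1 (y₁₋ s) ⟨ 1ˣ ⟩ ⟩
        eval F ⟨ 1ˣ ⟩              ≈⟨ eval-⟨⟩ F 1ˣ ⟩
        F 1ˣ                       ≈⟨ Y-congʳ {αValue (y 1ˣ)} {1# - proj₁ s}
                                     (trans (αValue-≈1 1ˣ refl) (sym (1-z≈0 s≈1))) (K []) m ⟩
        Y (1# - proj₁ s) (K []) m  ∎
      by-cases (no s≉1) = begin
        eval F L                   ≈⟨ eval-δ-≉1 F (proj₂ s) s≉1 (y₁₋ s) ⟨ 1ˣ ⟩ ⟩
        eval F (y₁₋ s)             ≈⟨ eval-y₁₋ F s s≉1 (λ s≉1′ →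
                                        Y-congʳ {αValue (y 1- proj₁ s [ s≉1′ ])} {1# - proj₁ s}
                                          (αValue-≉1 1- proj₁ s [ s≉1′ ] (1-z≉1 (proj₂ s)))
                                          (K []) m) ⟩
        Y (1# - proj₁ s) (K []) m  ∎

  ⋆-letter : ℂˣ → Lin ℂˣ
  ⋆-letter s = ⟨ 1ˣ ⟩ ⊟ δ (proj₁ s) • y₁₋ s

  -- The last factor of `⋆` depends on `s` alone, so it is summed first. What remains is a family
  -- indexed by the prefix, along which substitutions can be pulled back.
  ⋆-ending : ℂˣ → Word → ℕ → ℂ
  ⋆-ending s a m = eval (λ t → sˢʰ-word (a , t) m) (⋆-letter s)

  ⋆-ending-realises : ∀ s → Realises letterValue (⋆-ending s)
  ⋆-ending-realises s l w m = trans
    (eval-cong (λ t → sˢʰ-word-∷ l w t m) (⋆-letter s))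
    (sym (Y-eval (letterValue l) (λ t → sˢʰ-word (w , t)) (⋆-letter s) m))

  ∇-ending : ∀ s m → ∇ (sˢʰ-word ([] , s)) m ≈ ⋆-ending s [] m
  ∇-ending s@(z , z≉0) m = begin
    ∇ (sˢʰ-word ([] , s)) m
      ≈⟨ ∇-cong (sˢʰ-word-[] s) m ⟩
    ∇ (geometric z) m
      ≈⟨ +-identityʳ _ ⟨
    ∇ (geometric z) m + 0#
      -- The term for 1 - z is added and removed, since `∇-geometric` is stated without subtraction.
      ≈⟨ +-congˡ (-‿inverseʳ (geometric (1# - z) m)) ⟨
    ∇ (geometric z) m + (geometric (1# - z) m - geometric (1# - z) m)
      ≈⟨ +-assoc _ _ _ ⟨
    ∇ (geometric z) m + geometric (1# - z) m - geometric (1# - z) m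
      ≈⟨ +-congʳ (∇-geometric (z+[1-z]≈1 z) m) ⟩
    geometric 1# m - geometric (1# - z) m
      ≈⟨ +-cong (eval-⟨⟩ (λ t → geometric (proj₁ t) m) 1ˣ) (-‿cong (by-cases (z ≟ 1#))) ⟨
    eval F y₁ - eval F (δ z • y₁₋ s)
      ≈⟨ eval-⊟ F y₁ (δ z • y₁₋ s) ⟨
    eval F (⋆-letter s)
      ≈⟨ eval-cong (λ t → sˢʰ-word-[] t m) (⋆-letter s) ⟨
    ⋆-ending s [] m ∎
    where
    y₁ : Lin ℂˣ
    y₁ = ⟨ 1ˣ ⟩

    F : ℂˣ → ℂ
    F t = geometric (proj₁ t) m

    -- At z = 1 there is no letter y_0; the coefficient δ(1) = 0 and the vanishing of `geometric` at
    -- 0 agree.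
    by-cases : Dec (z ≈ 1#) → eval F (δ z • y₁₋ s) ≈ geometric (1# - z) m
    by-cases (yes z≈1) = begin
      eval F (δ z • y₁₋ s)    ≡⟨ ≡.cong (λ q → eval F (q • y₁₋ s)) (δ≡0 z≈1) ⟩
      eval F (0ℚ • y₁₋ s)     ≈⟨ eval-0• F (y₁₋ s) ⟩
      0#                      ≈⟨ trans (*-congʳ (trans (*-congʳ (1-z≈0 z≈1)) (zeroˡ _))) (zeroˡ _) ⟨
      geometric (1# - z) m    ∎
    by-cases (no z≉1) = begin
      eval F (δ z • y₁₋ s)    ≡⟨ ≡.cong (λ q → eval F (q • y₁₋ s)) (δ≡1 z≉0 z≉1) ⟩
      eval F (1ℚ • y₁₋ s)     ≈⟨ eval-1• F (y₁₋ s) ⟩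
      eval F (y₁₋ s)          ≈⟨ eval-y₁₋ F s z≉1 (λ _ → refl) ⟩
      geometric (1# - z) m    ∎

  -- Induction on the prefix. Both sides agree on the empty prefix by `∇-ending`, and each further
  -- letter acts by `Y` at `dualValue`: on the left by `∇-Y`, on the right by `ι-realises`.
  ∇-sˢʰ-word : ∀ u s m → ∇ (sˢʰ-word (u , s)) m ≈ pullback ιLetter (pullback αLetter (⋆-ending s)) u m
  ∇-sˢʰ-word []      s m = begin
    ∇ (sˢʰ-word ([] , s)) m                     ≈⟨ ∇-ending s m ⟩
    ⋆-ending s [] m                             ≈⟨ eval-⟨⟩ (λ a → ⋆-ending s a m) [] ⟨
    pullback αLetter (⋆-ending s) [] m                ≈⟨ eval-⟨⟩ (λ a → pullback αLetter (⋆-ending s) a m) [] ⟨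
    pullback ιLetter (pullback αLetter (⋆-ending s)) [] m   ∎
  ∇-sˢʰ-word (l ∷ u) s m = begin
    ∇ (sˢʰ-word (l ∷ u , s)) m
      ≈⟨ ∇-cong (sˢʰ-word-∷ l u s) m ⟩
    ∇ (Y (letterValue l) (sˢʰ-word (u , s))) m
      ≈⟨ ∇-Y (z+[1-z]≈1 (letterValue l)) (sˢʰ-word (u , s)) m ⟩
    Y (dualValue l) (∇ (sˢʰ-word (u , s))) m
      ≈⟨ Y-cong refl (∇-sˢʰ-word u s) m ⟩
    Y (dualValue l) (pullback ιLetter (pullback αLetter (⋆-ending s)) u) m
      ≈⟨ ι-realises (α-realises (⋆-ending-realises s)) l u m ⟨
    pullback ιLetter (pullback αLetter (⋆-ending s)) (l ∷ u) m ∎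

  sˢʰ-⋆ : ∀ u s m → sˢʰ (⋆ ⟨ u , s ⟩) m ≈ pullback ιLetter (pullback αLetter (⋆-ending s)) u m
  sˢʰ-⋆ u s m = begin
    sˢʰ (⋆ ⟨ u , s ⟩) m
      ≈⟨ eval-linear-⟨⟩ (λ w → sˢʰ-word w m) (λ (u , s) → α (ι ⟨ u ⟩) ·y ⋆-letter s) (u , s) ⟩
    eval (λ w → sˢʰ-word w m) (α (ι ⟨ u ⟩) ·y ⋆-letter s)
      ≈⟨ eval-bilinear (λ w → sˢʰ-word w m) _,_ (α (ι ⟨ u ⟩)) (⋆-letter s) ⟩
    eval (λ a → ⋆-ending s a m) (α (ι ⟨ u ⟩))
      ≡⟨ ≡.cong (eval (λ a → ⋆-ending s a m))
           (≡.trans (α≡ (ι ⟨ u ⟩)) (≡.cong (algebraHom αLetter) (ι≡ ⟨ u ⟩))) ⟩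
    eval (λ a → ⋆-ending s a m) (algebraHom αLetter (algebraHom ιLetter ⟨ u ⟩))
      ≈⟨ eval-algebraHom αLetter (λ a → ⋆-ending s a m) (algebraHom ιLetter ⟨ u ⟩) ⟩
    pullback ιLetter (pullback αLetter (⋆-ending s)) u m ∎

theorem2p6 : ∀ {c ℓ} (ℝ : RealNumbers c ℓ) (let open Words ℝ)
    {n : ℕ} (bs : Vec Block (suc n)) (m : ℕ) →
    ∇ (sˢʰ ⟨ word bs ⟩) m ≈ sˢʰ (⋆ ⟨ word bs ⟩) m
theorem2p6 ℝ bs m = begin
  ∇ (sˢʰ ⟨ word bs ⟩) m            ≈⟨ ∇-cong (λ i → eval-⟨⟩ (λ w → sˢʰ-word w i) (word bs)) m ⟩
  ∇ (sˢʰ-word (word bs)) m         ≈⟨ ∇-sˢʰ-word (proj₁ (word bs)) (proj₂ (word bs)) m ⟩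
  _                                ≈⟨ sˢʰ-⋆ (proj₁ (word bs)) (proj₂ (word bs)) m ⟨
  sˢʰ (⋆ ⟨ word bs ⟩) m            ∎
  where
  open Words ℝ
  open Sums ℝ
  open Evaluation ℝ
  open Duality ℝ
  open ≈-Reasoning setoid
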